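{- Let $k,\ell$ be integers with $k,\ell\geq 2$ and $2k\geq \ell$. Then $$C(C_{2k},C_\ell)=\frac{4k(k-1)}{2k\ell-2k-\ell}.$$
   Context: All graphs are finite and simple. $C_m$ denotes the cycle on $m$ vertices for $m\geq 3$, and by convention $C_2=K_2$ is the single edge. $\operatorname{hom}(H,T)$ is the number of maps $V(H)\to V(T)$ sending every edge of $H$ to an edge of $T$, $t(H,T)=\operatorname{hom}(H,T)/v(T)^{v(H)}$, and $C(G,H)=\min\{c\in\mathbb{R}: t(G,T)\geq t(H,T)^c \text{ for all graphs } T\}$. -}

module Defs where

open import Data.Bool using (Bool; true; false; not; _∨_; _∧_)
open import Data.Nat using (ℕ; zero; suc; _+_; _*_; _∸_; _^_; _≤_; _<_; _%_; _≡ᵇ_)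
open import Data.Fin using (Fin; toℕ)
open import Data.Vec using (Vec; []; _∷_; lookup)
open import Data.List using (List; []; _∷_; map; concatMap; allFin; foldr; filterᵇ; length)
open import Data.Product using (Σ; ∃; _×_; _,_)
open import Relation.Binary.PropositionalEquality using (_≡_)
open import Relation.Nullary using (¬_)

record SimpleGraph (n : ℕ) : Set where
  field
    adj    : Fin n → Fin n → Bool
    sym    : ∀ i j → adj i j ≡ adj j i
    irrefl : ∀ i → adj i i ≡ false
open SimpleGraph public

-- Adjacency of the cycle C_m on vertices Fin m (i ~ j iff j ≡ i+1 or i ≡ j+1 mod m).
-- For m ≥ 3 this is the cycle C_m; for m = 2 it is K_2 (the convention C_2 = K_2).
-- Only used for m ≥ 2.
cycleAdj : (m : ℕ) → Fin m → Fin m → Bool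
cycleAdj zero () _
cycleAdj (suc r) i j =
  (toℕ j ≡ᵇ ((toℕ i + 1) % suc r)) ∨ (toℕ i ≡ᵇ ((toℕ j + 1) % suc r))

allMaps : (n m : ℕ) → List (Vec (Fin n) m)
allMaps n zero = [] ∷ []
allMaps n (suc m) = concatMap (λ v → map (λ f → v ∷ f) (allMaps n m)) (allFin n)

allᵇ : {A : Set} → (A → Bool) → List A → Bool
allᵇ p = foldr (λ x acc → p x ∧ acc) true

isHom : {m n : ℕ} → (Fin m → Fin m → Bool) → SimpleGraph n → Vec (Fin n) m → Bool
isHom {m} adjH G f =
  allᵇ (λ i → allᵇ (λ j → not (adjH i j) ∨ adj G (lookup f i) (lookup f j)) (allFin m)) (allFin m)

hom : {m n : ℕ} → (Fin m → Fin m → Bool) → SimpleGraph n → ℕ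
hom {m} {n} adjH G = length (filterᵇ (isHom adjH G) (allMaps n m))

homCycle : (m : ℕ) {n : ℕ} → SimpleGraph n → ℕ
homCycle m = hom (cycleAdj m)

-- t(C_g,T) ≥ t(C_h,T)^(a/b) , i.e. t(C_g,T)^b ≥ t(C_h,T)^a (for b ≥ 1), written with
-- t(H,T) = hom(H,T)/n^{v(H)} and denominators cleared (n ≥ 1):
--   hom(C_g,T)^b * n^(h*a) ≥ hom(C_h,T)^a * n^(g*b).
CycleIneq : (g h a b : ℕ) {n : ℕ} → SimpleGraph n → Set
CycleIneq g h a b {n} T =
  homCycle h T ^ a * n ^ (g * b) ≤ homCycle g T ^ b * n ^ (h * a)

-- C(C_g, C_h) = p / r  (p, r ≥ 1), with C(G,H) = min{c : t(G,T) ≥ t(H,T)^c ∀ T}: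
--  (i) the inequality holds with exponent p/r for every graph T (with v(T) ≥ 1), and
--  (ii) for every positive rational a/b < p/r there is a graph T violating it.
CycleConstantIs : (g h p r : ℕ) → Set
CycleConstantIs g h p r =
  (∀ n (T : SimpleGraph n) → 1 ≤ n → CycleIneq g h p r T)
  × (∀ a b → 1 ≤ a → 1 ≤ b → a * r < p * b →
       Σ ℕ λ n → Σ (SimpleGraph n) λ T → 1 ≤ n × ¬ CycleIneq g h a b T)

{-# OPTIONS --safe #-}
module Submission where

-- Let A be the adjacency matrix of T on n vertices. Then hom(C_m, T) = tr A^m for m ≥ 2
-- (for m = 2 because A has 0/1 entries). By Cauchy–Schwarz (tr A^(i+j))² ≤ tr A^(2i) · tr A^(2j),
-- which interpolates tr A^ℓ between tr A² and tr A^(2k); together with Sidorenko's inequality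
-- (tr A²)^(2k) ≤ n^(2k) tr A^(2k) this gives the bound.
--
-- For sharpness put h = 2k, take a large prime p and let T have as vertices the p^h power series
-- modulo X^(h+1) over 𝔽_p with constant term 1, where u and v are adjacent iff they are distinct
-- and u = x (1 + s X), v = x (1 + t X) for some x, s, t. Thus T is a union of p^h cliques of size p,
-- any two of them sharing at most one vertex, and hom(C_ℓ, T) is at least a constant times p^h p^ℓ.
-- A closed walk of length 2k gives ∏ (1 + sᵢ X) ≡ ∏ (1 + tᵢ X) modulo X^(h+1), and since there are
-- only h factors on each side every tᵢ is one of the sⱼ; hence hom(C_2k, T) is at most a constant
-- times p^h p^h.

open import Defs renaming (sym to adj-sym)
open import Algebra.Bundles using (CommutativeRing)
open import Data.Fin using
  ( Fin; zero; suc; toℕ; fromℕ; fromℕ<; inject₁; inject≤; combine; quotient; remainder; funToFin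
  ; finToFun )
open import Data.Fin.Properties using
  ( any?; toℕ<n; toℕ-injective; toℕ-fromℕ; toℕ-fromℕ<; toℕ-inject₁; fromℕ<-toℕ; inject≤-injective
  ; combine-injective; combine-injectiveˡ; combine-injectiveʳ; combine-remQuot; funToFin-finToFin
  ; finToFun-funToFin; injective⇒≤ )
open import Data.Nat as ℕ using (ℕ; zero; suc; _≤_; _<_; z≤n; s≤s)
import Data.Nat.Properties as ℕ
open import Data.Nat.Primality using (Prime; euclidsLemma; prime⇒nonZero; prime⇒nonTrivial)
open import Data.Product using (_×_; _,_; proj₁; proj₂; Σ; ∃)
open import Data.Sum as Sum using (_⊎_; inj₁; inj₂)
open import Relation.Nullary using (¬_; Dec; yes; no; does; contradiction; ¬?; _×-dec_)
open import Relation.Nullary.Decidable using (map′; dec-true; does-⇔)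
import Relation.Binary.PropositionalEquality as ≡

-- Truncated power series

module TruncatedSeries {c ℓ} (R : CommutativeRing c ℓ) where
  open CommutativeRing R hiding (zero)
  open import Algebra.Properties.Group +-group using (∙-cancelˡ; ∙-cancelʳ)
  open import Algebra.Solver.Ring.NaturalCoefficients.Default commutativeSemiring
    using (solve; _:+_; _:*_; _:=_)
  open import Relation.Binary.Reasoning.Setoid setoid

  -- All coefficients are kept; truncation modulo X^(h+1) lives in the relation `_≈[_]_` alone, so
  -- that h can vary along an induction.
  Series : Set c
  Series = ℕ → Carrier

  infix 4 _≈[_]_

  _≈[_]_ : Series → ℕ → Series → Set ℓ
  u ≈[ h ] v = ∀ i → i ≤ h → u i ≈ v i

  ≈[]-sym : ∀ {h u v} → u ≈[ h ] v → v ≈[ h ] u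
  ≈[]-sym e i i≤h = sym (e i i≤h)

  ≈[]-trans : ∀ {h u v w} → u ≈[ h ] v → v ≈[ h ] w → u ≈[ h ] w
  ≈[]-trans e f i i≤h = trans (e i i≤h) (f i i≤h)

  -- Multiplication by 1 + s X.
  mul : Carrier → Series → Series
  mul s u zero    = u zero
  mul s u (suc i) = u (suc i) + s * u i

  mul-cong : ∀ {h s t u v} → s ≈ t → u ≈[ h ] v → mul s u ≈[ h ] mul t v
  mul-cong s≈t e zero    i≤h = e zero i≤h
  mul-cong s≈t e (suc i) i≤h = +-cong (e (suc i) i≤h) (*-cong s≈t (e i (ℕ.<⇒≤ i≤h)))

  mul-comm : ∀ s t u i → mul s (mul t u) i ≈ mul t (mul s u) i
  mul-comm s t u zero          = refl
  mul-comm s t u (suc zero)    = solve 3 (λ x y z → x :+ y :+ z := x :+ z :+ y) refl (u 1) (t * u 0) (s * u 0)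
  mul-comm s t u (suc (suc i)) =
    solve 5 (λ s t x y z → (x :+ t :* y) :+ s :* (y :+ t :* z) := (x :+ s :* y) :+ t :* (y :+ s :* z))
      refl s t (u (suc (suc i))) (u (suc i)) (u i)

  -- Coefficients are recovered from the bottom up: once those of index i agree, the terms `s * u i`
  -- and `s * v i` cancel in index `suc i`.
  mul-injective : ∀ {h s u v} → mul s u ≈[ h ] mul s v → u ≈[ h ] v
  mul-injective e zero    i≤h = e zero i≤h
  mul-injective {s = s} {u} {v} e (suc i) i≤h = ∙-cancelʳ (s * v i) _ _ (begin
    u (suc i) + s * v i ≈⟨ +-congˡ (*-congˡ (mul-injective e i (ℕ.<⇒≤ i≤h))) ⟨
    u (suc i) + s * u i ≈⟨ e (suc i) i≤h ⟩
    v (suc i) + s * v i ∎)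

  -- The coefficients of X differ only by s against t; `1 ≤ h` ensures that this coefficient is
  -- compared.
  mul-injectiveˡ : ∀ {h s t u} → 1 ≤ h → u 0 ≈ 1# → mul s u ≈[ h ] mul t u → s ≈ t
  mul-injectiveˡ {s = s} {t} {u} 1≤h u₀ e = begin
    s       ≈⟨ *-identityʳ s ⟨
    s * 1#  ≈⟨ *-congˡ u₀ ⟨
    s * u 0 ≈⟨ ∙-cancelˡ (u 1) _ _ (e 1 1≤h) ⟩
    t * u 0 ≈⟨ *-congˡ u₀ ⟩
    t * 1#  ≈⟨ *-identityʳ t ⟩
    t       ∎

  muls : ℕ → (ℕ → Carrier) → Series → Series
  muls zero    s u = u
  muls (suc m) s u = mul (s m) (muls m s u)

  muls-cong : ∀ {h} m {s u v} → u ≈[ h ] v → muls m s u ≈[ h ] muls m s v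
  muls-cong zero    e = e
  muls-cong (suc m) e = mul-cong refl (muls-cong m e)

  mul-muls : ∀ m s t u i → mul t (muls m s u) i ≈ muls m s (mul t u) i
  mul-muls zero    s t u i = refl
  mul-muls (suc m) s t u i = trans (mul-comm t (s m) (muls m s u) i)
    (mul-cong refl (λ j _ → mul-muls m s t u j) i ℕ.≤-refl)

  -- Each relation trades one factor 1 + t X for one factor 1 + s X while moving to the next series.
  -- Along a closed walk, where `v m` is `v 0`, this becomes an identity between two products of
  -- linear factors.
  muls-telescope : ∀ {h} m s t (v : ℕ → Series) →
    (∀ j → mul (t j) (v j) ≈[ h ] mul (s j) (v (suc j))) →
    muls m t (v 0) ≈[ h ] muls m s (v m)
  muls-telescope zero    s t v e i i≤h = refl
  muls-telescope (suc m) s t v e =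
    ≈[]-trans (mul-cong refl (muls-telescope m s t v e))
      (≈[]-trans (λ i _ → mul-muls m s (t m) (v m) i)
        (≈[]-trans (muls-cong m (e m)) (λ i _ → sym (mul-muls m s (s m) (v (suc m)) i))))

  -- The Cauchy product, with a recursion that shifts the first factor.
  conv : Series → Series → Series
  conv u v zero    = u 0 * v 0
  conv u v (suc i) = u 0 * v (suc i) + conv (λ j → u (suc j)) v i

  conv-cong : ∀ u {v w} i → v ≈[ i ] w → conv u v i ≈ conv u w i
  conv-cong u zero    e = *-congˡ (e 0 z≤n)
  conv-cong u (suc i) e = +-cong (*-congˡ (e (suc i) ℕ.≤-refl))
    (conv-cong (λ j → u (suc j)) i (λ j j≤i → e j (ℕ.m≤n⇒m≤1+n j≤i)))

  conv-mul : ∀ s u v i → conv u (mul s v) i ≈ mul s (conv u v) i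
  conv-mul s u v zero = refl
  conv-mul s u v (suc zero) =
    solve 5 (λ s a b x y → a :* (x :+ s :* y) :+ b :* y := a :* x :+ b :* y :+ s :* (a :* y))
      refl s (u 0) (u 1) (v 1) (v 0)
  conv-mul s u v (suc (suc i)) = begin
    u 0 * (v (suc (suc i)) + s * v (suc i)) + conv u′ (mul s v) (suc i)
      ≈⟨ +-congˡ (conv-mul s u′ v (suc i)) ⟩
    u 0 * (v (suc (suc i)) + s * v (suc i)) + (conv u′ v (suc i) + s * conv u′ v i)
      ≈⟨ solve 6 (λ s a x y c d → a :* (x :+ s :* y) :+ (c :+ s :* d) := a :* x :+ c :+ s :* (a :* y :+ d))
           refl s (u 0) (v (suc (suc i))) (v (suc i)) (conv u′ v (suc i)) (conv u′ v i) ⟩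
    u 0 * v (suc (suc i)) + conv u′ v (suc i) + s * (u 0 * v (suc i) + conv u′ v i) ∎
    where
    u′ : Series
    u′ j = u (suc j)

  one : Series
  one zero    = 1#
  one (suc _) = 0#

  conv-one : ∀ u i → conv u one i ≈ u i
  conv-one u zero    = *-identityʳ (u 0)
  conv-one u (suc i) = trans (+-cong (zeroʳ (u 0)) (conv-one (λ j → u (suc j)) i)) (+-identityˡ _)

  -- Splits off the starting series as a factor, so that `conv-cancel` can remove it and leave the
  -- bare products.
  muls-conv : ∀ m s u i → muls m s u i ≈ conv u (muls m s one) i
  muls-conv zero    s u i = sym (conv-one u i)
  muls-conv (suc m) s u i = trans
    (mul-cong refl (λ j _ → muls-conv m s u j) i ℕ.≤-refl)
    (sym (conv-mul (s m) u (muls m s one) i))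

  -- A constant term 1 makes u cancellable: in index `suc h` the new coefficient of v enters only
  -- through `u 0 * v (suc h)`, and the rest involves lower coefficients, which agree by induction.
  conv-cancel : ∀ {u v w} h → u 0 ≈ 1# → conv u v ≈[ h ] conv u w → v ≈[ h ] w
  conv-cancel {u} {v} {w} zero u₀ e .0 z≤n = unit-cancel u₀ (e 0 z≤n)
    where
    unit-cancel : ∀ {a x y} → a ≈ 1# → a * x ≈ a * y → x ≈ y
    unit-cancel a≈1 ax≈ay = trans (sym (trans (*-congʳ a≈1) (*-identityˡ _)))
      (trans ax≈ay (trans (*-congʳ a≈1) (*-identityˡ _)))
  conv-cancel {u} {v} {w} (suc h) u₀ e i i≤1+h with ℕ.m≤n⇒m<n∨m≡n i≤1+h
  ... | inj₁ (s≤s i≤h) = conv-cancel h u₀ (λ j j≤h → e j (ℕ.m≤n⇒m≤1+n j≤h)) i i≤h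
  ... | inj₂ ≡.refl = begin
    v (suc h)       ≈⟨ *-identityˡ _ ⟨
    1# * v (suc h)  ≈⟨ *-congʳ u₀ ⟨
    u 0 * v (suc h) ≈⟨ ∙-cancelʳ _ _ _ (trans (e (suc h) ℕ.≤-refl) (+-congˡ (sym lower))) ⟩
    u 0 * w (suc h) ≈⟨ *-congʳ u₀ ⟩
    1# * w (suc h)  ≈⟨ *-identityˡ _ ⟩
    w (suc h)       ∎
    where
    lower : conv (λ j → u (suc j)) v h ≈ conv (λ j → u (suc j)) w h
    lower = conv-cong (λ j → u (suc j)) h (conv-cancel h u₀ (λ j j≤h → e j (ℕ.m≤n⇒m≤1+n j≤h)))

  -- Σ_{i ≤ m} v i · y^(m - i): the reversed polynomial of v, evaluated at y.
  eval : Carrier → ℕ → Series → Carrier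
  eval y zero    v = v 0
  eval y (suc m) v = y * eval y m v + v (suc m)

  eval-cong : ∀ y m {v w} → v ≈[ m ] w → eval y m v ≈ eval y m w
  eval-cong y zero    e = e 0 z≤n
  eval-cong y (suc m) e = +-cong (*-congˡ (eval-cong y m (λ j j≤m → e j (ℕ.m≤n⇒m≤1+n j≤m)))) (e (suc m) ℕ.≤-refl)

  -- When v has degree at most m the last term vanishes, and a factor 1 + s X contributes a factor y
  -- + s to the reversed polynomial.
  eval-mul : ∀ y m s v → eval y (suc m) (mul s v) ≈ (y + s) * eval y m v + v (suc m)
  eval-mul y zero s v = solve 4 (λ y s a b → y :* a :+ (b :+ s :* a) := (y :+ s) :* a :+ b) refl y s (v 0) (v 1)
  eval-mul y (suc m) s v = trans (+-congʳ (*-congˡ (eval-mul y m s v)))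
    (solve 5 (λ y s e a b → y :* ((y :+ s) :* e :+ a) :+ (b :+ s :* a) := (y :+ s) :* (y :* e :+ a) :+ b)
      refl y s (eval y m v) (v (suc m)) (v (suc (suc m))))

  muls-one-vanish : ∀ m s i → m < i → muls m s one i ≈ 0#
  muls-one-vanish zero s (suc i) _ = refl
  muls-one-vanish (suc m) s (suc i) (s≤s m<i) = trans
    (+-cong (muls-one-vanish m s (suc i) (ℕ.m≤n⇒m≤1+n m<i)) (trans (*-congˡ (muls-one-vanish m s i m<i)) (zeroʳ _)))
    (+-identityˡ 0#)

  ∏ : ℕ → (ℕ → Carrier) → Carrier
  ∏ zero    f = 1#
  ∏ (suc m) f = f m * ∏ m f

  eval-muls : ∀ y m s → eval y m (muls m s one) ≈ ∏ m (λ j → y + s j)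
  eval-muls y zero    s = refl
  eval-muls y (suc m) s = begin
    eval y (suc m) (mul (s m) (muls m s one))
      ≈⟨ eval-mul y m (s m) (muls m s one) ⟩
    (y + s m) * eval y m (muls m s one) + muls m s one (suc m)
      ≈⟨ +-cong (*-congˡ (eval-muls y m s)) (muls-one-vanish m s (suc m) ℕ.≤-refl) ⟩
    (y + s m) * ∏ m (λ j → y + s j) + 0#
      ≈⟨ +-identityʳ _ ⟩
    (y + s m) * ∏ m (λ j → y + s j) ∎

  ∏-zero : ∀ m f j → j < m → f j ≈ 0# → ∏ m f ≈ 0#
  ∏-zero (suc m) f j (s≤s j≤m) fj≈0 with ℕ.m≤n⇒m<n∨m≡n j≤m
  ... | inj₁ j<m    = trans (*-congˡ (∏-zero m f j j<m fj≈0)) (zeroʳ _)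
  ... | inj₂ ≡.refl = trans (*-congʳ fj≈0) (zeroˡ _)

  module _ (1≉0 : ¬ 1# ≈ 0#) (zero-product : ∀ x y → x * y ≈ 0# → x ≈ 0# ⊎ y ≈ 0#) where

    ∏-zero⁻¹ : ∀ m f → ∏ m f ≈ 0# → ∃ λ j → j < m × f j ≈ 0#
    ∏-zero⁻¹ zero    f e = contradiction e 1≉0
    ∏-zero⁻¹ (suc m) f e with zero-product _ _ e
    ... | inj₁ fm≈0 = m , ℕ.≤-refl , fm≈0
    ... | inj₂ rest with ∏-zero⁻¹ m f rest
    ...   | j , j<m , fj≈0 = j , ℕ.m≤n⇒m≤1+n j<m , fj≈0

    -- With at most h factors, ∏ (1 + s X) is known exactly from its class modulo X^(h+1);
    -- then - t is a root of the reversed polynomial for every factor 1 + t X.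
    muls-roots : ∀ {h} m s t u → m ≤ h → u 0 ≈ 1# → muls m t u ≈[ h ] muls m s u →
      ∀ j → j < m → ∃ λ j′ → j′ < m × s j′ ≈ t j
    muls-roots {h} m s t u m≤h u₀ e j j<m = equal (∏-zero⁻¹ m (λ i → - t j + s i) (begin
      ∏ m (λ i → - t j + s i)        ≈⟨ eval-muls (- t j) m s ⟨
      eval (- t j) m (muls m s one)  ≈⟨ eval-cong (- t j) m (λ i i≤m → cancelled i (ℕ.≤-trans i≤m m≤h)) ⟨
      eval (- t j) m (muls m t one)  ≈⟨ eval-muls (- t j) m t ⟩
      ∏ m (λ i → - t j + t i)        ≈⟨ ∏-zero m _ j j<m (-‿inverseˡ (t j)) ⟩
      0#                             ∎))
      where
      cancelled : muls m t one ≈[ h ] muls m s one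
      cancelled = conv-cancel h u₀ (λ i i≤h →
        trans (sym (muls-conv m t u i)) (trans (e i i≤h) (muls-conv m s u i)))
      equal : (∃ λ j′ → j′ < m × - t j + s j′ ≈ 0#) → ∃ λ j′ → j′ < m × s j′ ≈ t j
      equal (j′ , j′<m , z) = j′ , j′<m , ∙-cancelˡ (- t j) _ _ (trans z (sym (-‿inverseˡ (t j))))

open ≡

-- Integers modulo p

module Modular (p : ℕ) where

  open import Data.Integer as ℤ using (ℤ; +_; -_; _+_; _*_; _-_; 0ℤ; 1ℤ; ∣_∣)
  import Data.Integer.Properties as ℤ
  open import Data.Integer.DivMod using (_%ℕ_; _/ℕ_; n%ℕd<d; a≡a%ℕn+[a/ℕn]*n)
  open import Data.Integer.Divisibility.Signed using
    ( _∣_; _∣?_; divides; ∣ᵤ⇒∣; ∣⇒∣ᵤ; ∣m∣n⇒∣m+n; ∣m⇒∣-m; ∣n⇒∣m*n )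
  open import Data.Integer.Tactic.RingSolver using (solve-∀)
  import Data.Nat.Divisibility as ℕ
  open import Level using (0ℓ)

  infix 4 _≈ₚ_

  record _≈ₚ_ (x y : ℤ) : Set where
    constructor congruent
    field p∣x-y : + p ∣ x - y

  open _≈ₚ_

  _≈ₚ?_ : ∀ x y → Dec (x ≈ₚ y)
  x ≈ₚ? y = map′ congruent p∣x-y (+ p ∣? x - y)

  private
    via : ∀ {x y z} → z ≡ x - y → + p ∣ z → x ≈ₚ y
    via refl d = congruent d

  ≈ₚ-reflexive : ∀ {x y} → x ≡ y → x ≈ₚ y
  ≈ₚ-reflexive {x} refl = congruent (divides 0ℤ (ℤ.+-inverseʳ x))

  ≈ₚ-sym : ∀ {x y} → x ≈ₚ y → y ≈ₚ x
  ≈ₚ-sym {x} {y} (congruent d) = via (eq x y) (∣m⇒∣-m d)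
    where
    eq : ∀ x y → - (x - y) ≡ y - x
    eq = solve-∀

  ≈ₚ-trans : ∀ {x y z} → x ≈ₚ y → y ≈ₚ z → x ≈ₚ z
  ≈ₚ-trans {x} {y} {z} (congruent d) (congruent e) = via (eq x y z) (∣m∣n⇒∣m+n d e)
    where
    eq : ∀ x y z → (x - y) + (y - z) ≡ x - z
    eq = solve-∀

  +-cong : ∀ {x y u v} → x ≈ₚ y → u ≈ₚ v → x + u ≈ₚ y + v
  +-cong {x} {y} {u} {v} (congruent d) (congruent e) = via (eq x y u v) (∣m∣n⇒∣m+n d e)
    where
    eq : ∀ x y u v → (x - y) + (u - v) ≡ (x + u) - (y + v)
    eq = solve-∀

  *-cong : ∀ {x y u v} → x ≈ₚ y → u ≈ₚ v → x * u ≈ₚ y * v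
  *-cong {x} {y} {u} {v} (congruent d) (congruent e) = via (eq x y u v) (∣m∣n⇒∣m+n (∣n⇒∣m*n u d) (∣n⇒∣m*n y e))
    where
    eq : ∀ x y u v → u * (x - y) + y * (u - v) ≡ x * u - y * v
    eq = solve-∀

  neg-cong : ∀ {x y} → x ≈ₚ y → - x ≈ₚ - y
  neg-cong {x} {y} (congruent d) = via (eq x y) (∣m⇒∣-m d)
    where
    eq : ∀ x y → - (x - y) ≡ - x - - y
    eq = solve-∀

  -- The ring is ℤ with congruence as its equality, so that the ring laws come from ℤ; `ι` and
  -- `reduce` pass between it and the representatives in `Fin p`.
  ℤ/p : CommutativeRing 0ℓ 0ℓ
  ℤ/p = record
    { Carrier = ℤ ; _≈_ = _≈ₚ_ ; _+_ = _+_ ; _*_ = _*_ ; -_ = -_ ; 0# = 0ℤ ; 1# = 1ℤ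
    ; isCommutativeRing = record
      { isRing = record
        { +-isAbelianGroup = record
          { isGroup = record
            { isMonoid = record
              { isSemigroup = record
                { isMagma = record
                  { isEquivalence = record { refl = ≈ₚ-reflexive refl ; sym = ≈ₚ-sym ; trans = ≈ₚ-trans }
                  ; ∙-cong = +-cong }
                ; assoc = λ x y z → ≈ₚ-reflexive (ℤ.+-assoc x y z) }
              ; identity = (λ x → ≈ₚ-reflexive (ℤ.+-identityˡ x)) , (λ x → ≈ₚ-reflexive (ℤ.+-identityʳ x)) }
            ; inverse = (λ x → ≈ₚ-reflexive (ℤ.+-inverseˡ x)) , (λ x → ≈ₚ-reflexive (ℤ.+-inverseʳ x))
            ; ⁻¹-cong = neg-cong }
          ; comm = λ x y → ≈ₚ-reflexive (ℤ.+-comm x y) }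
        ; *-cong = *-cong
        ; *-assoc = λ x y z → ≈ₚ-reflexive (ℤ.*-assoc x y z)
        ; *-identity = (λ x → ≈ₚ-reflexive (ℤ.*-identityˡ x)) , (λ x → ≈ₚ-reflexive (ℤ.*-identityʳ x))
        ; distrib = (λ x y z → ≈ₚ-reflexive (ℤ.*-distribˡ-+ x y z)) , (λ x y z → ≈ₚ-reflexive (ℤ.*-distribʳ-+ x y z)) }
      ; *-comm = λ x y → ≈ₚ-reflexive (ℤ.*-comm x y) } }

  ∣⇒≈0 : ∀ {x} → p ℕ.∣ ∣ x ∣ → x ≈ₚ 0ℤ
  ∣⇒≈0 {x} d = via (sym (ℤ.+-identityʳ x)) (∣ᵤ⇒∣ d)

  ≈0⇒∣ : ∀ {x} → x ≈ₚ 0ℤ → p ℕ.∣ ∣ x ∣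
  ≈0⇒∣ {x} (congruent d) = ∣⇒∣ᵤ (subst (+ p ∣_) (ℤ.+-identityʳ x) d)

  ι : Fin p → ℤ
  ι a = + toℕ a

  -- Two representatives are at distance less than p, so a difference divisible by p is zero.
  ι-injective : ∀ {a b} → ι a ≈ₚ ι b → a ≡ b
  ι-injective {a} {b} (congruent d) = toℕ-injective (ℤ.+-injective
    (ℤ.i-j≡0⇒i≡j (ι a) (ι b) (ℤ.∣i∣≡0⇒i≡0 (multiple<p (∣⇒∣ᵤ d) distance<p))))
    where
    multiple<p : ∀ {k} → p ℕ.∣ k → k < p → k ≡ 0
    multiple<p {zero}  _   _   = refl
    multiple<p {suc k} p∣k k<p = contradiction (ℕ.∣⇒≤ p∣k) (ℕ.<⇒≱ k<p)
    distance<p : ∣ ι a - ι b ∣ < p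
    distance<p = ℕ.≤-<-trans
      (subst (ℕ._≤ toℕ a ℕ.⊔ toℕ b) (cong ∣_∣ (sym (ℤ.m-n≡m⊖n (toℕ a) (toℕ b)))) (ℤ.∣m⊝n∣≤m⊔n (toℕ a) (toℕ b)))
      (ℕ.⊔-lub (toℕ<n a) (toℕ<n b))

  reduce : .{{_ : ℕ.NonZero p}} → ℤ → Fin p
  reduce x = fromℕ< (n%ℕd<d x p)

  ι-reduce : .{{_ : ℕ.NonZero p}} → ∀ x → ι (reduce x) ≈ₚ x
  ι-reduce x = ≈ₚ-sym (congruent (divides (x /ℕ p) (begin
    x - ι (reduce x)                              ≡⟨ cong (λ r → x - + r) (toℕ-fromℕ< (n%ℕd<d x p)) ⟩
    x - + (x %ℕ p)                                ≡⟨ cong (_- + (x %ℕ p)) (a≡a%ℕn+[a/ℕn]*n x p) ⟩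
    + (x %ℕ p) + (x /ℕ p) * + p - + (x %ℕ p)      ≡⟨ eq (+ (x %ℕ p)) ((x /ℕ p) * + p) ⟩
    (x /ℕ p) * + p                                ∎)))
    where
    open ≡-Reasoning
    eq : ∀ a b → a + b - a ≡ b
    eq = solve-∀

  module _ (isPrime : Prime p) where

    1≉0 : ¬ 1ℤ ≈ₚ 0ℤ
    1≉0 e = ℕ.nonTrivial⇒≢1 ⦃ prime⇒nonTrivial isPrime ⦄ (ℕ.∣1⇒≡1 (≈0⇒∣ e))

    zero-product : ∀ x y → x * y ≈ₚ 0ℤ → x ≈ₚ 0ℤ ⊎ y ≈ₚ 0ℤ
    zero-product x y e = Sum.map ∣⇒≈0 ∣⇒≈0
      (euclidsLemma ∣ x ∣ ∣ y ∣ isPrime (subst (p ℕ.∣_) (ℤ.abs-* x y) (≈0⇒∣ e)))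

open import Data.Bool using (Bool; true; false; if_then_else_; not; _∧_; _∨_; T)
open import Data.Bool.Properties using (⇔→≡; T-≡; T-∨; T?)
import Data.Fin as Fin
open import Data.Fin.Relation.Unary.Top using (view; ‵fromℕ; ‵inject₁)
open import Data.Integer using (ℤ; 0ℤ; 1ℤ)
open import Data.List as List using (List; []; _∷_; map; concatMap; allFin; filterᵇ; length; _++_)
open import Data.List.Membership.Propositional using (_∈_; lose)
open import Data.List.Membership.Propositional.Properties using
  ( ∈-map⁺; ∈-concatMap⁺; ∈-filter⁺; ∈-filter⁻; ∈-allFin; ∈-lookup )
open import Data.List.Properties using (length-++; filter-++)
open import Data.List.Relation.Unary.All as All using ([]; _∷_)
open import Data.List.Relation.Unary.AllPairs using ([]; _∷_)
open import Data.List.Relation.Unary.Any using (here; index)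
open import Data.List.Relation.Unary.Any.Properties using (lookup-index)
open import Data.List.Relation.Unary.Unique.Propositional using (Unique)
open import Data.List.Relation.Unary.Unique.Propositional.Properties using
  ( allFin⁺; filter⁺; cartesianProductWith⁺ )
open import Data.Nat using
  ( _+_; _*_; _∸_; _^_; _!; _%_; _/_; _<?_; _≡ᵇ_; NonZero; s≤s⁻¹; ≢-nonZero⁻¹; >-nonZero⁻¹
  ; nonTrivial⇒≢1 )
open import Data.Nat.Divisibility using (_∣_; ∣-trans; ∣m+n∣m⇒∣n; ∣1⇒≡1; m∣m*n; m≤n⇒m!∣n!)
open import Data.Nat.DivMod using
  ( _mod_; m%n<n; n%n≡0; m<n⇒m%n≡m; %-distribˡ-+; m%n%n≡m%n; m≡m%n+[m/n]*n; m/n*n≤m; m≥n⇒m/n>0 )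
open import Data.Nat.Primality.Factorisation using (factorise)
open import Data.Nat.Properties hiding (_≟_)
open import Data.Nat.Tactic.RingSolver using (solve-∀)
open import Data.Vec as Vec using (Vec; []; _∷_; lookup; tabulate; _∷ʳ_)
open import Data.Vec.Properties using (∷-injective; lookup∘tabulate; tabulate∘lookup; tabulate-cong)
open import Function using (_∘_; id; _⇔_; mk⇔; Equivalence)
open import Algebra.Properties.Semiring.Sum +-*-semiring using
  ( sum; sum-cong-≗; ∑-distrib-+; ∑-comm; *-distribˡ-sum; *-distribʳ-sum )

open Equivalence

-- Cauchy–Schwarz

-- An abstraction of finite sums: one proof of Cauchy-Schwarz then serves sums over vertices and,
-- through `_⊗_`, sums over pairs of vertices.
record PositiveFunctional (X : Set) : Set where
  field
    ⟪_⟫   : (X → ℕ) → ℕ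
    mono  : ∀ {f g} → (∀ x → f x ≤ g x) → ⟪ f ⟫ ≤ ⟪ g ⟫
    additive : ∀ f g → ⟪ (λ x → f x + g x) ⟫ ≡ ⟪ f ⟫ + ⟪ g ⟫
    scale : ∀ c f → ⟪ (λ x → c * f x) ⟫ ≡ c * ⟪ f ⟫

  ext : ∀ {f g} → (∀ x → f x ≡ g x) → ⟪ f ⟫ ≡ ⟪ g ⟫
  ext e = ≤-antisym (mono (λ x → ≤-reflexive (e x))) (mono (λ x → ≤-reflexive (sym (e x))))

open PositiveFunctional

_⊗_ : ∀ {X Y} → PositiveFunctional X → PositiveFunctional Y → PositiveFunctional (X × Y)
S ⊗ T = record
  { ⟪_⟫ = λ f → ⟪ S ⟫ (λ x → ⟪ T ⟫ (λ y → f (x , y)))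
  ; mono = λ f≤g → mono S (λ x → mono T (λ y → f≤g (x , y)))
  ; additive = λ f g → trans (ext S (λ x → additive T _ _)) (additive S _ _)
  ; scale = λ c f → trans (ext S (λ x → scale T c _)) (scale S c _)
  }

product-⊗ : ∀ {X Y} (S : PositiveFunctional X) (T : PositiveFunctional Y) f g →
  ⟪ S ⊗ T ⟫ (λ (x , y) → f x * g y) ≡ ⟪ S ⟫ f * ⟪ T ⟫ g
product-⊗ S T f g = trans (ext S λ x → trans (scale T (f x) g) (*-comm (f x) _))
                      (trans (scale S (⟪ T ⟫ g) f) (*-comm (⟪ T ⟫ g) (⟪ S ⟫ f)))

2mn≤m²+n²-ordered : ∀ {m n} → m ≤ n → 2 * (m * n) ≤ m * m + n * n
2mn≤m²+n²-ordered {m} m≤n with m≤n⇒∃[o]m+o≡n m≤n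
... | d , refl = ≤-trans (m≤m+n _ (d * d)) (≤-reflexive (identity m d))
  where
  identity : ∀ m d → 2 * (m * (m + d)) + d * d ≡ m * m + (m + d) * (m + d)
  identity = solve-∀

2mn≤m²+n² : ∀ m n → 2 * (m * n) ≤ m * m + n * n
2mn≤m²+n² m n with ≤-total m n
... | inj₁ m≤n = 2mn≤m²+n²-ordered m≤n
... | inj₂ n≤m = subst₂ _≤_ (cong (2 *_) (*-comm n m)) (+-comm (n * n) _) (2mn≤m²+n²-ordered n≤m)

-- The square on the left is a double sum of f(x)g(x)f(y)g(y), regrouped as the product of f(x)g(y)
-- and g(x)f(y). AM-GM for these two numbers, summed over x and y, gives twice the right-hand side
-- without leaving ℕ.
cauchy-schwarz : ∀ {X} (S : PositiveFunctional X) (f g : X → ℕ) →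
  ⟪ S ⟫ (λ x → f x * g x) * ⟪ S ⟫ (λ x → f x * g x) ≤
  ⟪ S ⟫ (λ x → f x * f x) * ⟪ S ⟫ (λ x → g x * g x)
cauchy-schwarz S f g = *-cancelˡ-≤ 2 (begin
  2 * (∫ fg * ∫ fg)
    ≡⟨ cong (2 *_) (product-⊗ S S fg fg) ⟨
  2 * ∫ (λ x → ∫ λ y → fg x * fg y)
    ≡⟨ trans (ext S (λ x → scale S 2 _)) (scale S 2 _) ⟨
  ∫ (λ x → ∫ λ y → 2 * (fg x * fg y))
    ≤⟨ mono S (λ x → mono S (λ y → am-gm (f x) (g x) (f y) (g y))) ⟩
  ∫ (λ x → ∫ λ y → ff x * gg y + gg x * ff y)
    ≡⟨ trans (ext S (λ x → additive S _ _)) (additive S _ _) ⟩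
  ∫ (λ x → ∫ λ y → ff x * gg y) + ∫ (λ x → ∫ λ y → gg x * ff y)
    ≡⟨ cong₂ _+_ (product-⊗ S S ff gg) (product-⊗ S S gg ff) ⟩
  ∫ ff * ∫ gg + ∫ gg * ∫ ff
    ≡⟨ double (∫ ff) (∫ gg) ⟩
  2 * (∫ ff * ∫ gg) ∎)
  where
  open ≤-Reasoning
  ∫ = ⟪ S ⟫
  fg = λ x → f x * g x
  ff = λ x → f x * f x
  gg = λ x → g x * g x
  double : ∀ a b → a * b + b * a ≡ 2 * (a * b)
  double = solve-∀
  regroupˡ : ∀ a b c d → 2 * ((a * d) * (b * c)) ≡ 2 * ((a * b) * (c * d))
  regroupˡ = solve-∀
  regroupʳ : ∀ a b c d → (a * d) * (a * d) + (b * c) * (b * c) ≡ (a * a) * (d * d) + (b * b) * (c * c)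
  regroupʳ = solve-∀
  am-gm : ∀ a b c d → 2 * ((a * b) * (c * d)) ≤ (a * a) * (d * d) + (b * b) * (c * c)
  am-gm a b c d = subst₂ _≤_ (regroupˡ a b c d) (regroupʳ a b c d) (2mn≤m²+n² (a * d) (b * c))

sum-mono : ∀ {n} {f g : Fin n → ℕ} → (∀ i → f i ≤ g i) → sum f ≤ sum g
sum-mono {zero}  f≤g = z≤n
sum-mono {suc n} f≤g = +-mono-≤ (f≤g zero) (sum-mono (λ i → f≤g (suc i)))

∑ : ∀ n → PositiveFunctional (Fin n)
∑ n = record
  { ⟪_⟫ = sum
  ; mono = sum-mono
  ; additive = ∑-distrib-+
  ; scale = λ c f → sym (*-distribˡ-sum c f)
  }

-- Log-convex sequences

module LogConvex (a : ℕ → ℕ) (convex : ∀ i → a (suc i) * a (suc i) ≤ a i * a (2 + i)) where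

  -- The quotients of consecutive terms do not decrease; the statement is cross-multiplied to avoid
  -- division.
  ratio-mono : ∀ i d → a (suc i) * a (d + i) ≤ a i * a (suc d + i)
  ratio-mono i zero = ≤-reflexive (*-comm (a (suc i)) (a i))
  ratio-mono i (suc d) = cancel (a (suc d + i)) refl
    where
    open ≤-Reasoning
    b = a (suc d + i)
    c = a (2 + d + i)
    cancel : ∀ m → b ≡ m → a (suc i) * b ≤ a i * c
    -- The factor b cannot be cancelled when it is 0, but then the left-hand side is 0.
    cancel zero b≡0 = subst (λ z → a (suc i) * z ≤ a i * c) (sym b≡0)
                        (≤-trans (≤-reflexive (*-zeroʳ (a (suc i)))) z≤n)
    cancel (suc m) b≡1+m = *-cancelʳ-≤ _ _ b ⦃ subst NonZero (sym b≡1+m) _ ⦄ (begin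
      a (suc i) * b * b         ≡⟨ *-assoc (a (suc i)) b b ⟩
      a (suc i) * (b * b)       ≤⟨ *-monoʳ-≤ (a (suc i)) (convex (d + i)) ⟩
      a (suc i) * (a (d + i) * c) ≡⟨ *-assoc (a (suc i)) _ c ⟨
      a (suc i) * a (d + i) * c ≤⟨ *-monoˡ-≤ c (ratio-mono i d) ⟩
      a i * b * c               ≡⟨ swap (a i) b c ⟩
      a i * c * b               ∎)
      where
      swap : ∀ x y z → x * y * z ≡ x * z * y
      swap = solve-∀

  -- The quotient of `a j` by `a 0` is a product of j consecutive ratios, each at most the ratio of
  -- `a (suc d + j)` to `a (d + j)`.
  telescope : ∀ j d → a (d + j) ^ j * a j ≤ a 0 * a (suc d + j) ^ j
  telescope zero d = ≤-reflexive (trans (*-identityˡ (a 0)) (sym (*-identityʳ (a 0))))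
  telescope (suc j) d rewrite +-suc d j = begin
    b ^ suc j * a (suc j)      ≡⟨ r₁ b (b ^ j) (a (suc j)) ⟩
    b ^ j * (a (suc j) * b)    ≤⟨ *-monoʳ-≤ (b ^ j) (ratio-mono j (suc d)) ⟩
    b ^ j * (a j * c)          ≡⟨ *-assoc (b ^ j) (a j) c ⟨
    b ^ j * a j * c            ≤⟨ *-monoˡ-≤ c (telescope j (suc d)) ⟩
    a 0 * c ^ j * c            ≡⟨ r₂ (a 0) (c ^ j) c ⟩
    a 0 * c ^ suc j            ∎
    where
    open ≤-Reasoning
    b = a (suc d + j)
    c = a (2 + d + j)
    r₁ : ∀ x y z → x * y * z ≡ y * (z * x)
    r₁ = solve-∀
    r₂ : ∀ x y z → x * y * z ≡ x * (z * y)
    r₂ = solve-∀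

  -- The logarithm of a at j lies below the chord from 0 to i + j. In the induction on i,
  -- `telescope` moves the right end of the chord by one.
  interpolate : ∀ i j → a j ^ (i + j) ≤ a 0 ^ i * a (i + j) ^ j
  interpolate zero j = ≤-reflexive (sym (*-identityˡ _))
  interpolate (suc i) j = begin
    a j * a j ^ (i + j)                 ≤⟨ *-monoʳ-≤ (a j) (interpolate i j) ⟩
    a j * (a 0 ^ i * a (i + j) ^ j)     ≡⟨ r₁ (a j) (a 0 ^ i) _ ⟩
    a 0 ^ i * (a (i + j) ^ j * a j)     ≤⟨ *-monoʳ-≤ (a 0 ^ i) (telescope j i) ⟩
    a 0 ^ i * (a 0 * a (suc i + j) ^ j) ≡⟨ r₂ (a 0 ^ i) (a 0) _ ⟩
    a 0 ^ suc i * a (suc i + j) ^ j     ∎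
    where
    open ≤-Reasoning
    r₁ : ∀ x y z → x * (y * z) ≡ y * (z * x)
    r₁ = solve-∀
    r₂ : ∀ x y z → x * (y * z) ≡ y * x * z
    r₂ = solve-∀

-- Walk counts

𝟙 : Bool → ℕ
𝟙 b = if b then 1 else 0

δ : ∀ {n} → Fin n → Fin n → ℕ
δ zero zero = 1
δ zero (suc j) = 0
δ (suc i) zero = 0
δ (suc i) (suc j) = δ i j

sum-δ : ∀ {n} (i : Fin n) (f : Fin n → ℕ) → sum (λ j → δ i j * f j) ≡ f i
sum-δ {suc n} zero f = trans (cong₂ _+_ (*-identityˡ (f zero)) (sum-0 n)) (+-identityʳ (f zero))
  where
  sum-0 : ∀ n → sum {n} (λ _ → 0) ≡ 0
  sum-0 zero = refl
  sum-0 (suc n) = sum-0 n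
sum-δ {suc n} (suc i) f = sum-δ i (λ j → f (suc j))

δ-sym : ∀ {n} (i j : Fin n) → δ i j ≡ δ j i
δ-sym zero zero = refl
δ-sym zero (suc j) = refl
δ-sym (suc i) zero = refl
δ-sym (suc i) (suc j) = δ-sym i j

module Walks {n} (T : SimpleGraph n) where

  A : Fin n → Fin n → ℕ
  A u v = 𝟙 (adj T u v)

  W : ℕ → Fin n → Fin n → ℕ
  W zero u v = δ u v
  W (suc k) u v = sum λ w → A u w * W k w v

  W-+ : ∀ i j u v → W (i + j) u v ≡ sum λ w → W i u w * W j w v
  W-+ zero j u v = sym (sum-δ u (λ w → W j w v))
  W-+ (suc i) j u v = begin
    sum (λ x → A u x * W (i + j) x v)
      ≡⟨ sum-cong-≗ (λ x → cong (A u x *_) (W-+ i j x v)) ⟩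
    sum (λ x → A u x * sum λ w → W i x w * W j w v)
      ≡⟨ sum-cong-≗ (λ x → trans (*-distribˡ-sum (A u x) (λ w → W i x w * W j w v))
           (sum-cong-≗ λ w → sym (*-assoc (A u x) (W i x w) _))) ⟩
    sum (λ x → sum λ w → A u x * W i x w * W j w v)
      ≡⟨ ∑-comm (λ x w → A u x * W i x w * W j w v) ⟩
    sum (λ w → sum λ x → A u x * W i x w * W j w v)
      ≡⟨ sum-cong-≗ (λ w → *-distribʳ-sum (W j w v) (λ x → A u x * W i x w)) ⟨
    sum (λ w → W (suc i) u w * W j w v) ∎
    where
    open ≡-Reasoning

  W-1 : ∀ u v → W 1 u v ≡ A u v
  W-1 u v = trans (sum-cong-≗ λ w → trans (*-comm (A u w) (δ w v)) (cong (_* A u w) (δ-sym w v)))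
              (sum-δ v (λ w → A u w))

  W-sym : ∀ k u v → W k u v ≡ W k v u
  W-sym zero u v = δ-sym u v
  W-sym (suc k) u v = begin
    sum (λ w → A u w * W k w v) ≡⟨ sum-cong-≗ (λ w → trans (*-comm (A u w) _)
       (cong₂ _*_ (W-sym k w v) (trans (cong 𝟙 (adj-sym T u w)) (sym (W-1 w u))))) ⟩
    sum (λ w → W k v w * W 1 w u)       ≡⟨ W-+ k 1 v u ⟨
    W (k + 1) v u                       ≡⟨ cong (λ m → W m v u) (+-comm k 1) ⟩
    W (suc k) v u                       ∎
    where open ≡-Reasoning

  tr : ℕ → ℕ
  tr m = sum λ u → W m u u

  walks : ℕ → ℕ
  walks k = sum λ u → sum λ v → W k u v

  ends : ℕ → Fin n → ℕ
  ends k u = sum λ v → W k u v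

  -- Since A^j is symmetric, the trace is the entrywise inner product of A^i and A^j, the form to
  -- which Cauchy-Schwarz applies.
  tr-+ : ∀ i j → tr (i + j) ≡ sum λ u → sum λ v → W i u v * W j u v
  tr-+ i j = sum-cong-≗ λ u → trans (W-+ i j u u) (sum-cong-≗ λ v → cong (W i u v *_) (W-sym j v u))

  tr-log-convex : ∀ i j → tr (i + j) * tr (i + j) ≤ tr (i + i) * tr (j + j)
  tr-log-convex i j rewrite tr-+ i j | tr-+ i i | tr-+ j j =
    cauchy-schwarz (∑ n ⊗ ∑ n) (λ (u , v) → W i u v) (λ (u , v) → W j u v)

  ends-+ : ∀ i j u → ends (i + j) u ≡ sum λ w → W i u w * ends j w
  ends-+ i j u = begin
    sum (λ v → W (i + j) u v)                ≡⟨ sum-cong-≗ (W-+ i j u) ⟩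
    sum (λ v → sum λ w → W i u w * W j w v)  ≡⟨ ∑-comm (λ v w → W i u w * W j w v) ⟩
    sum (λ w → sum λ v → W i u w * W j w v)  ≡⟨ sum-cong-≗ (λ w → *-distribˡ-sum (W i u w) (W j w)) ⟨
    sum (λ w → W i u w * ends j w)           ∎
    where open ≡-Reasoning

  -- By symmetry of A^i, the number of walks is the inner product of the vectors A^i 1 and A^j 1.
  walks-+ : ∀ i j → walks (i + j) ≡ sum λ u → ends i u * ends j u
  walks-+ i j = begin
    sum (λ u → ends (i + j) u)                 ≡⟨ sum-cong-≗ (ends-+ i j) ⟩
    sum (λ u → sum λ w → W i u w * ends j w)   ≡⟨ ∑-comm (λ u w → W i u w * ends j w) ⟩
    sum (λ w → sum λ u → W i u w * ends j w)
      ≡⟨ sum-cong-≗ (λ w → *-distribʳ-sum (ends j w) (λ u → W i u w)) ⟨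
    sum (λ w → sum (λ u → W i u w) * ends j w)
      ≡⟨ sum-cong-≗ (λ w → cong (_* ends j w) (sum-cong-≗ λ u → W-sym i u w)) ⟩
    sum (λ w → ends i w * ends j w)            ∎
    where open ≡-Reasoning

  walks-log-convex : ∀ i j → walks (i + j) * walks (i + j) ≤ walks (i + i) * walks (j + j)
  walks-log-convex i j rewrite walks-+ i j | walks-+ i i | walks-+ j j =
    cauchy-schwarz (∑ n) (ends i) (ends j)

  -- Cauchy–Schwarz for the pairing of A^k with the rank-one matrix (A^i 1)(A^j 1)ᵀ.
  walks²≤tr : ∀ i k j → walks (i + (k + j)) * walks (i + (k + j)) ≤
                        tr (k + k) * (walks (i + i) * walks (j + j))
  walks²≤tr i k j = begin
    walks (i + (k + j)) * walks (i + (k + j))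
      ≡⟨ cong₂ _*_ pairing pairing ⟩
    ⟪ S ⟫ (λ z → F z * G z) * ⟪ S ⟫ (λ z → F z * G z)
      ≤⟨ cauchy-schwarz S F G ⟩
    ⟪ S ⟫ (λ z → F z * F z) * ⟪ S ⟫ (λ z → G z * G z)
      ≡⟨ cong₂ _*_ (sym (tr-+ k k)) norm ⟩
    tr (k + k) * (walks (i + i) * walks (j + j)) ∎
    where
    open ≤-Reasoning
    S = ∑ n ⊗ ∑ n
    F G : Fin n × Fin n → ℕ
    F (u , v) = W k u v
    G (u , v) = ends i u * ends j v
    r₁ : ∀ a b c → a * (b * c) ≡ b * (a * c)
    r₁ = solve-∀
    r₂ : ∀ a b → (a * b) * (a * b) ≡ (a * a) * (b * b)
    r₂ = solve-∀
    pairing : walks (i + (k + j)) ≡ ⟪ S ⟫ (λ z → F z * G z)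
    pairing = trans (walks-+ i (k + j)) (sum-cong-≗ λ u →
      trans (cong (ends i u *_) (ends-+ k j u)) (trans (*-distribˡ-sum (ends i u) (λ v → W k u v * ends j v))
        (sum-cong-≗ λ v → r₁ (ends i u) (W k u v) (ends j v))))
    norm : ⟪ S ⟫ (λ z → G z * G z) ≡ walks (i + i) * walks (j + j)
    norm = trans (ext S (λ (u , v) → r₂ (ends i u) (ends j v)))
      (trans (product-⊗ (∑ n) (∑ n) (λ u → ends i u * ends i u) (λ v → ends j v * ends j v))
        (cong₂ _*_ (sym (walks-+ i i)) (sym (walks-+ j j))))

-- Traces of powers

-- Used with c = ℓ - 2, d = 2k - ℓ and m = k - 1. Here c and d have the same parity, and this parity
-- decides how tr A^ℓ is compared with traces of even powers.
data Balanced : ℕ → ℕ → ℕ → Set where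
  even : ∀ e f → Balanced (e + e) (f + f) (f + e)
  odd  : ∀ e f → Balanced (1 + (e + e)) (1 + (f + f)) (1 + (f + e))

balanced : ∀ c d m → c + d ≡ m + m → Balanced c d m
balanced zero d m refl = subst (Balanced 0 (m + m)) (+-identityʳ m) (even 0 m)
balanced (suc zero) d (suc m) eq with refl ← trans (suc-injective eq) (+-suc m m) =
  subst (λ x → Balanced 1 (suc (m + m)) (suc x)) (+-identityʳ m) (odd 0 m)
balanced (suc (suc c)) d (suc m) eq = step (balanced c d m (suc-injective (trans (suc-injective eq) (+-suc m m))))
  where
  step : ∀ {c d m} → Balanced c d m → Balanced (2 + c) d (suc m)
  step (even e f) = subst₂ (λ x y → Balanced x (f + f) y) (cong suc (+-suc e e)) (+-suc f e) (even (suc e) f)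
  step (odd e f) = subst₂ (λ x y → Balanced x (1 + (f + f)) y) (cong (2 +_) (+-suc e e)) (cong suc (+-suc f e)) (odd (suc e) f)

^-distribʳ-* : ∀ o m n → (m * n) ^ o ≡ m ^ o * n ^ o
^-distribʳ-* zero m n = refl
^-distribʳ-* (suc o) m n = trans (cong (m * n *_) (^-distribʳ-* o m n)) ([m*n]*[o*p]≡[m*o]*[n*p] m n (m ^ o) (n ^ o))

data Halving : ℕ → Set where
  twice   : ∀ j → Halving (j + j)
  1+twice : ∀ j → Halving (suc (j + j))

halve : ∀ k → Halving k
halve zero = twice 0
halve (suc k) with halve k
... | twice j   = 1+twice j
... | 1+twice j = subst Halving (cong suc (+-suc j j)) (twice (suc j))

module _ {n} (T : SimpleGraph n) where
  open Walks T

  -- Traces of odd powers vanish for bipartite graphs, so log-convexity is claimed for even powers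
  -- only. The shift puts tr A² at index 0, the lower end in `interpolate`.
  evenTr : ℕ → ℕ
  evenTr i = tr (suc i + suc i)

  evenTr-convex : ∀ i → evenTr (suc i) * evenTr (suc i) ≤ evenTr i * evenTr (2 + i)
  evenTr-convex i = subst (λ m → tr m * tr m ≤ evenTr i * evenTr (2 + i)) (shift i)
                      (tr-log-convex (1 + i) (3 + i))
    where
    shift : ∀ i → (1 + i) + (3 + i) ≡ (2 + i) + (2 + i)
    shift = solve-∀

  module EvenTr = LogConvex evenTr evenTr-convex

  evenWalks : ℕ → ℕ
  evenWalks i = walks (i + i)

  evenWalks-convex : ∀ i → evenWalks (suc i) * evenWalks (suc i) ≤ evenWalks i * evenWalks (2 + i)
  evenWalks-convex i = subst (λ m → walks m * walks m ≤ evenWalks i * evenWalks (2 + i)) (shift i)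
                         (walks-log-convex i (2 + i))
    where
    shift : ∀ i → i + (2 + i) ≡ (1 + i) + (1 + i)
    shift = solve-∀

  module EvenWalks = LogConvex evenWalks evenWalks-convex

  -- For even c this is the square of an instance of `interpolate`. For odd c, Cauchy-Schwarz first
  -- bounds the square of tr A^(2+c) by the product of the two neighbouring even traces, and each of
  -- these is interpolated.
  tr-interpolate : ∀ {c d m} → Balanced c d m →
    tr (2 + c) ^ (c + d) ≤ tr 2 ^ d * evenTr m ^ c
  tr-interpolate (even e f) = begin
    tr (2 + (e + e)) ^ (e + e + (f + f))
      ≡⟨ cong₂ _^_ (cong tr (cong suc (sym (+-suc e e)))) (r₁ e f) ⟩
    evenTr e ^ (f + e + (f + e))
      ≡⟨ ^-distribˡ-+-* (evenTr e) (f + e) (f + e) ⟩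
    evenTr e ^ (f + e) * evenTr e ^ (f + e)
      ≤⟨ *-mono-≤ (EvenTr.interpolate f e) (EvenTr.interpolate f e) ⟩
    (tr 2 ^ f * y ^ e) * (tr 2 ^ f * y ^ e)
      ≡⟨ [m*n]*[o*p]≡[m*o]*[n*p] (tr 2 ^ f) (y ^ e) _ _ ⟩
    (tr 2 ^ f * tr 2 ^ f) * (y ^ e * y ^ e)
      ≡⟨ cong₂ _*_ (^-distribˡ-+-* (tr 2) f f) (^-distribˡ-+-* y e e) ⟨
    tr 2 ^ (f + f) * y ^ (e + e) ∎
    where
    open ≤-Reasoning
    y = evenTr (f + e)
    r₁ : ∀ e f → e + e + (f + f) ≡ f + e + (f + e)
    r₁ = solve-∀
  tr-interpolate (odd e f) = begin
    x ^ (1 + (e + e) + (1 + (f + f)))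
      ≡⟨ cong (x ^_) (r₁ e f) ⟩
    x ^ (2 * M)
      ≡⟨ ^-*-assoc x 2 M ⟨
    (x ^ 2) ^ M
      ≤⟨ ^-monoˡ-≤ M step ⟩
    (evenTr e * evenTr (suc e)) ^ M
      ≡⟨ ^-distribʳ-* M (evenTr e) _ ⟩
    evenTr e ^ M * evenTr (suc e) ^ M
      ≤⟨ *-mono-≤ (EvenTr.interpolate (suc f) e)
           (subst (λ m → evenTr (suc e) ^ m ≤ tr 2 ^ f * evenTr m ^ suc e) (+-suc f e) (EvenTr.interpolate f (suc e))) ⟩
    (tr 2 ^ suc f * y ^ e) * (tr 2 ^ f * y ^ suc e)
      ≡⟨ [m*n]*[o*p]≡[m*o]*[n*p] (tr 2 ^ suc f) (y ^ e) _ _ ⟩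
    (tr 2 ^ suc f * tr 2 ^ f) * (y ^ e * y ^ suc e)
      ≡⟨ cong₂ _*_ (^-distribˡ-+-* (tr 2) (suc f) f) (trans (cong (y ^_) (sym (+-suc e e))) (^-distribˡ-+-* y e (suc e))) ⟨
    tr 2 ^ (1 + (f + f)) * y ^ (1 + (e + e)) ∎
    where
    open ≤-Reasoning
    x = tr (2 + (1 + (e + e)))
    M = suc f + e
    y = evenTr M
    r₁ : ∀ e f → 1 + (e + e) + (1 + (f + f)) ≡ 2 * (suc f + e)
    r₁ = solve-∀
    r₂ : ∀ e → suc e + (2 + e) ≡ 2 + (1 + (e + e))
    r₂ = solve-∀
    step : x ^ 2 ≤ evenTr e * evenTr (suc e)
    step = ≤-trans (≤-reflexive (cong (x *_) (*-identityʳ x)))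
      (subst (λ m → tr m * tr m ≤ evenTr e * evenTr (suc e)) (r₂ e) (tr-log-convex (suc e) (2 + e)))

  -- Sidorenko's inequality for even cycles

  walks-0 : walks 0 ≡ n
  walks-0 = trans (sum-cong-≗ {n} λ u → trans (sum-cong-≗ λ v → sym (*-identityʳ (δ u v))) (sum-δ u (λ _ → 1))) (sum-1 n)
    where
    sum-1 : ∀ n → sum {n} (λ _ → 1) ≡ n
    sum-1 zero = refl
    sum-1 (suc n) = cong suc (sum-1 n)

  -- Interpolation between the walk counts of length 0, which number n, and of length 2i + 2, taken
  -- at length 2.
  walks-2≤walks-even : ∀ i → walks 2 ^ suc i ≤ n ^ i * walks (suc i + suc i)
  walks-2≤walks-even i = subst₂ (λ a m → walks 2 ^ m ≤ a ^ i * walks (m + m)) walks-0 (+-comm i 1)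
    (subst (λ z → walks 2 ^ (i + 1) ≤ walks 0 ^ i * z) (*-identityʳ _) (EvenWalks.interpolate i 1))

  -- For even k, pairing A^k with the all-ones matrix involves `walks k`, whose length is even, so
  -- `walks-2≤walks-even` applies to it.
  walks-2≤tr-even : ∀ i → let k = suc i + suc i in walks 2 ^ k ≤ tr (k + k) * n ^ k
  walks-2≤tr-even i = begin
    walks 2 ^ k
      ≡⟨ ^-distribˡ-+-* (walks 2) (suc i) (suc i) ⟩
    walks 2 ^ suc i * walks 2 ^ suc i
      ≤⟨ *-mono-≤ (walks-2≤walks-even i) (walks-2≤walks-even i) ⟩
    (n ^ i * walks k) * (n ^ i * walks k)
      ≡⟨ [m*n]*[o*p]≡[m*o]*[n*p] (n ^ i) (walks k) _ _ ⟩
    (n ^ i * n ^ i) * (walks k * walks k)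
      ≤⟨ *-monoʳ-≤ (n ^ i * n ^ i) (subst₂ (λ a b → walks a * walks a ≤ tr (k + k) * (b * b))
           (+-identityʳ k) walks-0 (walks²≤tr 0 k 0)) ⟩
    (n ^ i * n ^ i) * (tr (k + k) * (n * n))
      ≡⟨ r (n ^ i) (tr (k + k)) n ⟩
    tr (k + k) * (n ^ suc i * n ^ suc i)
      ≡⟨ cong (tr (k + k) *_) (^-distribˡ-+-* n (suc i) (suc i)) ⟨
    tr (k + k) * n ^ k ∎
    where
    open ≤-Reasoning
    k = suc i + suc i
    r : ∀ a t n → (a * a) * (t * (n * n)) ≡ t * ((n * a) * (n * a))
    r = solve-∀

  -- Pairing A^k with the vectors A 1 and 1 (rather than 1 and 1) makes only walks of
  -- even length occur, and these have log-convex counts.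
  walks-2≤tr-odd : ∀ j → let k = suc (j + j) in walks 2 ^ k ≤ tr (k + k) * n ^ k
  walks-2≤tr-odd j = cancel (walks 2) refl
    where
    open ≤-Reasoning
    k = suc (j + j)
    r : ∀ a t w n → (a * a) * (t * (w * n)) ≡ t * (n * (a * a)) * w
    r = solve-∀
    walks² : walks (suc j + suc j) * walks (suc j + suc j) ≤ tr (k + k) * (walks 2 * n)
    walks² = subst₂ (λ a b → walks a * walks a ≤ tr (k + k) * (walks 2 * b))
               (cong suc (trans (+-identityʳ k) (sym (+-suc j j)))) walks-0 (walks²≤tr 1 k 0)
    cancel : ∀ w → walks 2 ≡ w → walks 2 ^ k ≤ tr (k + k) * n ^ k
    -- As k is a successor, the left-hand side is 0 here. In the other case the factor `walks 2`,
    -- brought in by the vector A 1, can be cancelled.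
    cancel zero eq = subst (λ w → w ^ k ≤ tr (k + k) * n ^ k) (sym eq) z≤n
    cancel (suc w) eq = *-cancelʳ-≤ _ _ (walks 2) ⦃ subst NonZero (sym eq) _ ⦄ (begin
      walks 2 ^ k * walks 2
        ≡⟨ trans (*-comm _ (walks 2)) (cong (walks 2 ^_) (cong suc (sym (+-suc j j)))) ⟩
      walks 2 ^ (suc j + suc j)
        ≡⟨ ^-distribˡ-+-* (walks 2) (suc j) (suc j) ⟩
      walks 2 ^ suc j * walks 2 ^ suc j
        ≤⟨ *-mono-≤ (walks-2≤walks-even j) (walks-2≤walks-even j) ⟩
      (n ^ j * walks (suc j + suc j)) * (n ^ j * walks (suc j + suc j))
        ≡⟨ [m*n]*[o*p]≡[m*o]*[n*p] (n ^ j) (walks (suc j + suc j)) _ _ ⟩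
      (n ^ j * n ^ j) * (walks (suc j + suc j) * walks (suc j + suc j))
        ≤⟨ *-monoʳ-≤ (n ^ j * n ^ j) walks² ⟩
      (n ^ j * n ^ j) * (tr (k + k) * (walks 2 * n))
        ≡⟨ r (n ^ j) (tr (k + k)) (walks 2) n ⟩
      tr (k + k) * (n * (n ^ j * n ^ j)) * walks 2
        ≡⟨ cong (λ x → tr (k + k) * (n * x) * walks 2) (^-distribˡ-+-* n j j) ⟨
      tr (k + k) * n ^ k * walks 2 ∎)

  walks-2≤tr : ∀ k → 1 ≤ k → walks 2 ^ k ≤ tr (k + k) * n ^ k
  walks-2≤tr k 1≤k with halve k
  ... | twice zero = contradiction 1≤k λ ()
  ... | twice (suc i) = walks-2≤tr-even i
  ... | 1+twice j = walks-2≤tr-odd j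

  -- The entries of A are 0 or 1, hence equal to their squares.
  tr-2 : tr 2 ≡ walks 1
  tr-2 = trans (tr-+ 1 1) (sum-cong-≗ λ u → sum-cong-≗ λ v →
    trans (cong (λ x → x * x) (W-1 u v)) (trans (idem (adj T u v)) (sym (W-1 u v))))
    where
    idem : ∀ b → 𝟙 b * 𝟙 b ≡ 𝟙 b
    idem false = refl
    idem true = refl

  -- The proof goes through `walks 2`, the sum of the squared degrees: Cauchy-Schwarz bounds the
  -- square of `walks 1` by n times it, and `walks-2≤tr` bounds its k-th power.
  sidorenko : ∀ k → 1 ≤ k → tr 2 ^ (k + k) ≤ tr (k + k) * n ^ (k + k)
  sidorenko k 1≤k = begin
    tr 2 ^ (k + k)              ≡⟨ cong (_^ (k + k)) tr-2 ⟩
    w ^ (k + k)                 ≡⟨ ^-distribˡ-+-* w k k ⟩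
    w ^ k * w ^ k               ≡⟨ ^-distribʳ-* k w w ⟨
    (w * w) ^ k
      ≤⟨ ^-monoˡ-≤ k (subst (λ a → w * w ≤ a * walks 2) walks-0 (walks-log-convex 0 1)) ⟩
    (n * walks 2) ^ k           ≡⟨ ^-distribʳ-* k n (walks 2) ⟩
    n ^ k * walks 2 ^ k         ≤⟨ *-monoʳ-≤ (n ^ k) (walks-2≤tr k 1≤k) ⟩
    n ^ k * (tr (k + k) * n ^ k) ≡⟨ r (n ^ k) (tr (k + k)) ⟩
    tr (k + k) * (n ^ k * n ^ k) ≡⟨ cong (tr (k + k) *_) (^-distribˡ-+-* n k k) ⟨
    tr (k + k) * n ^ (k + k)    ∎
    where
    open ≤-Reasoning
    w = walks 1
    r : ∀ a t → a * (t * a) ≡ t * (a * a)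
    r = solve-∀

  -- The g-th power of `tr-interpolate` contains d copies of (tr A²)^g, and `sidorenko` replaces
  -- each by tr A^g times n^g. This leaves tr A^g with exponent d + c g.
  tr-inequality : ∀ c d m → c + d ≡ m + m → let g = 2 + (c + d) in
    tr (2 + c) ^ (g * (c + d)) * n ^ (g * (d + c * g)) ≤
    tr g ^ (d + c * g) * n ^ ((2 + c) * (g * (c + d)))
  tr-inequality c d m eq = begin
    x ^ (g * (c + d)) * N
      ≡⟨ cong (_* N) (trans (cong (x ^_) (*-comm g (c + d))) (sym (^-*-assoc x (c + d) g))) ⟩
    (x ^ (c + d)) ^ g * N
      ≤⟨ *-monoˡ-≤ N (^-monoˡ-≤ g (subst (λ t → x ^ (c + d) ≤ z ^ d * tr t ^ c) g≡ (tr-interpolate (balanced c d m eq)))) ⟩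
    (z ^ d * y ^ c) ^ g * N             ≡⟨ cong (_* N) (^-distribʳ-* g (z ^ d) (y ^ c)) ⟩
    (z ^ d) ^ g * (y ^ c) ^ g * N
      ≡⟨ cong (_* N) (cong₂ _*_ (trans (^-*-assoc z d g) (trans (cong (z ^_) (*-comm d g)) (sym (^-*-assoc z g d)))) (^-*-assoc y c g)) ⟩
    (z ^ g) ^ d * y ^ (c * g) * N
      ≤⟨ *-monoˡ-≤ N (*-monoˡ-≤ (y ^ (c * g)) (^-monoˡ-≤ d (subst (λ t → z ^ t ≤ tr t * n ^ t) g≡ (sidorenko (suc m) (s≤s z≤n))))) ⟩
    (y * n ^ g) ^ d * y ^ (c * g) * N
      ≡⟨ cong (λ t → t * y ^ (c * g) * N) (trans (^-distribʳ-* d y (n ^ g)) (cong (y ^ d *_) (^-*-assoc n g d))) ⟩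
    y ^ d * n ^ (g * d) * y ^ (c * g) * N ≡⟨ r₁ (y ^ d) (n ^ (g * d)) (y ^ (c * g)) N ⟩
    (y ^ d * y ^ (c * g)) * (n ^ (g * d) * N)
      ≡⟨ cong₂ _*_ (^-distribˡ-+-* y d (c * g)) (^-distribˡ-+-* n (g * d) (g * (d + c * g))) ⟨
    y ^ (d + c * g) * n ^ (g * d + g * (d + c * g)) ≡⟨ cong (λ t → y ^ (d + c * g) * n ^ t) (r₂ c d) ⟩
    y ^ (d + c * g) * n ^ ((2 + c) * (g * (c + d))) ∎
    where
    open ≤-Reasoning
    g = 2 + (c + d)
    x = tr (2 + c)
    y = tr g
    z = tr 2
    N = n ^ (g * (d + c * g))
    g≡ : suc m + suc m ≡ g
    g≡ = cong suc (trans (+-suc m m) (cong suc (sym eq)))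
    r₁ : ∀ a b c d → a * b * c * d ≡ (a * c) * (b * d)
    r₁ = solve-∀
    r₂ : ∀ c d → (2 + (c + d)) * d + (2 + (c + d)) * (d + c * (2 + (c + d))) ≡ (2 + c) * ((2 + (c + d)) * (c + d))
    r₂ = solve-∀

-- Homomorphisms from cycles

next : ∀ {r} → Fin (suc r) → Fin (suc r)
next {r} i = fromℕ< (m%n<n (toℕ i + 1) (suc r))

toℕ-next : ∀ {r} (i : Fin (suc r)) → toℕ (next i) ≡ (toℕ i + 1) % suc r
toℕ-next {r} i = toℕ-fromℕ< (m%n<n (toℕ i + 1) (suc r))

next-fromℕ : ∀ r → next (fromℕ r) ≡ zero
next-fromℕ r = toℕ-injective (trans (toℕ-next (fromℕ r))
  (trans (cong (_% suc r) (trans (cong (_+ 1) (toℕ-fromℕ r)) (+-comm r 1))) (n%n≡0 (suc r))))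

next-inject₁ : ∀ {r} (i : Fin r) → next (inject₁ i) ≡ suc i
next-inject₁ {r} i = toℕ-injective (trans (toℕ-next (inject₁ i))
  (trans (cong (_% suc r) (trans (cong (_+ 1) (toℕ-inject₁ i)) (+-comm (toℕ i) 1))) (m<n⇒m%n≡m (s≤s (toℕ<n i)))))

allᵇ-tabulate : ∀ {A : Set} {m} (p : A → Bool) (g : Fin m → A) →
  allᵇ p (List.tabulate g) ≡ true ⇔ (∀ i → p (g i) ≡ true)
allᵇ-tabulate {m = zero} p g = mk⇔ (λ _ ()) (λ _ → refl)
allᵇ-tabulate {m = suc m} p g = mk⇔ fwd bwd
  where
  rec = allᵇ-tabulate p (g ∘ suc)
  fwd : p (g zero) ∧ allᵇ p (List.tabulate (g ∘ suc)) ≡ true → ∀ i → p (g i) ≡ true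
  fwd e i with p (g zero) in eq
  fwd e zero | true = eq
  fwd e (suc i) | true = to rec e i
  bwd : (∀ i → p (g i) ≡ true) → p (g zero) ∧ allᵇ p (List.tabulate (g ∘ suc)) ≡ true
  bwd h rewrite h zero = from rec (h ∘ suc)

isHom⇔ : ∀ {m n} (adjH : Fin m → Fin m → Bool) (G : SimpleGraph n) f →
  isHom adjH G f ≡ true ⇔ (∀ i j → adjH i j ≡ true → adj G (lookup f i) (lookup f j) ≡ true)
isHom⇔ adjH G f = mk⇔
  (λ h i j → implies (to (allᵇ-tabulate _ id) (to (allᵇ-tabulate _ id) h i) j))
  (λ h → from (allᵇ-tabulate _ id) (λ i → from (allᵇ-tabulate _ id) (λ j → implied (h i j))))
  where
  implies : ∀ {a b} → not a ∨ b ≡ true → a ≡ true → b ≡ true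
  implies e refl = e
  implied : ∀ {a b} → (a ≡ true → b ≡ true) → not a ∨ b ≡ true
  implied {false} h = refl
  implied {true} h = h refl

cycleAdj⇔ : ∀ {r} (i j : Fin (suc r)) → cycleAdj (suc r) i j ≡ true ⇔ (j ≡ next i ⊎ i ≡ next j)
cycleAdj⇔ {r} i j = mk⇔ fwd bwd
  where
  ≡next : ∀ (i j : Fin (suc r)) → T (toℕ j ≡ᵇ (toℕ i + 1) % suc r) → j ≡ next i
  ≡next i j t = toℕ-injective (trans (≡ᵇ⇒≡ _ _ t) (sym (toℕ-next i)))
  next≡ : ∀ (i j : Fin (suc r)) → j ≡ next i → T (toℕ j ≡ᵇ (toℕ i + 1) % suc r)
  next≡ i j e = ≡⇒≡ᵇ _ _ (trans (cong toℕ e) (toℕ-next i))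
  fwd : cycleAdj (suc r) i j ≡ true → j ≡ next i ⊎ i ≡ next j
  fwd e with to T-∨ (from T-≡ e)
  ... | inj₁ t = inj₁ (≡next i j t)
  ... | inj₂ t = inj₂ (≡next j i t)
  bwd : j ≡ next i ⊎ i ≡ next j → cycleAdj (suc r) i j ≡ true
  bwd (inj₁ e) = to T-≡ (from T-∨ (inj₁ (next≡ i j e)))
  bwd (inj₂ e) = to T-≡ (from (T-∨ {toℕ j ≡ᵇ (toℕ i + 1) % suc r}) (inj₂ (next≡ j i e)))

-- Every edge of the cycle occurs in both orientations; the backward ones follow from the symmetry
-- of G.
isHom-cycle⇔ : ∀ {r n} (G : SimpleGraph n) (f : Vec (Fin n) (suc r)) →
  isHom (cycleAdj (suc r)) G f ≡ true ⇔ (∀ i → adj G (lookup f i) (lookup f (next i)) ≡ true)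
isHom-cycle⇔ {r} G f = mk⇔
  (λ h i → to (isHom⇔ _ G f) h i (next i) (from (cycleAdj⇔ i (next i)) (inj₁ refl)))
  (λ h → from (isHom⇔ _ G f) (λ i j a → edge h i j (to (cycleAdj⇔ i j) a)))
  where
  edge : (∀ i → adj G (lookup f i) (lookup f (next i)) ≡ true) →
         ∀ i j → j ≡ next i ⊎ i ≡ next j → adj G (lookup f i) (lookup f j) ≡ true
  edge h i .(next i) (inj₁ refl) = h i
  edge h .(next j) j (inj₂ refl) = trans (adj-sym G _ _) (h j)

module _ {n} (G : SimpleGraph n) where

  -- The end e is kept independent of the start u so that induction on the inner vertices is
  -- possible; closed walks are the case e = u.
  walkᵇ : ∀ {r} → Fin n → Vec (Fin n) r → Fin n → Bool
  walkᵇ u [] e = adj G u e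
  walkᵇ u (v ∷ vs) e = adj G u v ∧ walkᵇ v vs e

  walkᵇ⇔ : ∀ {r} u (vs : Vec (Fin n) r) e →
    walkᵇ u vs e ≡ true ⇔ (∀ i → adj G (lookup (u ∷ vs) i) (lookup (vs ∷ʳ e) i) ≡ true)
  walkᵇ⇔ u [] e = mk⇔ (λ { h zero → h }) (λ h → h zero)
  walkᵇ⇔ u (v ∷ vs) e = mk⇔ fwd bwd
    where
    fwd : adj G u v ∧ walkᵇ v vs e ≡ true → ∀ i → adj G (lookup (u ∷ v ∷ vs) i) (lookup (v ∷ (vs ∷ʳ e)) i) ≡ true
    fwd h i with adj G u v in eq
    fwd h zero | true = eq
    fwd h (suc i) | true = to (walkᵇ⇔ v vs e) h i
    bwd : (∀ i → adj G (lookup (u ∷ v ∷ vs) i) (lookup (v ∷ (vs ∷ʳ e)) i) ≡ true) → adj G u v ∧ walkᵇ v vs e ≡ true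
    bwd h rewrite h zero = from (walkᵇ⇔ v vs e) (h ∘ suc)

  lookup-∷ʳ-fromℕ : ∀ {r} (vs : Vec (Fin n) r) e → lookup (vs ∷ʳ e) (fromℕ r) ≡ e
  lookup-∷ʳ-fromℕ [] e = refl
  lookup-∷ʳ-fromℕ (v ∷ vs) e = lookup-∷ʳ-fromℕ vs e

  lookup-∷ʳ-inject₁ : ∀ {r} (vs : Vec (Fin n) r) e i → lookup (vs ∷ʳ e) (inject₁ i) ≡ lookup vs i
  lookup-∷ʳ-inject₁ (v ∷ vs) e zero = refl
  lookup-∷ʳ-inject₁ (v ∷ vs) e (suc i) = lookup-∷ʳ-inject₁ vs e i

  -- `vs ∷ʳ u` is the cyclic shift of `u ∷ vs`: the last index wraps around to `zero`.
  lookup-next : ∀ {r} u (vs : Vec (Fin n) r) i → lookup (vs ∷ʳ u) i ≡ lookup (u ∷ vs) (next i)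
  lookup-next {r} u vs i with view i
  ... | ‵fromℕ = trans (lookup-∷ʳ-fromℕ vs u) (sym (cong (lookup (u ∷ vs)) (next-fromℕ r)))
  ... | ‵inject₁ j = trans (lookup-∷ʳ-inject₁ vs u j) (sym (cong (lookup (u ∷ vs)) (next-inject₁ j)))

  isHom-cycle≡walkᵇ : ∀ {r} u (vs : Vec (Fin n) r) → isHom (cycleAdj (suc r)) G (u ∷ vs) ≡ walkᵇ u vs u
  isHom-cycle≡walkᵇ u vs = ⇔→≡ (mk⇔
    (λ h → from (walkᵇ⇔ u vs u) (λ i → trans (cong (adj G _) (lookup-next u vs i)) (to (isHom-cycle⇔ G (u ∷ vs)) h i)))
    (λ h → from (isHom-cycle⇔ G (u ∷ vs)) (λ i → trans (cong (adj G _) (sym (lookup-next u vs i))) (to (walkᵇ⇔ u vs u) h i))))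

count : ∀ {A : Set} → (A → Bool) → List A → ℕ
count p xs = length (filterᵇ p xs)

count-cong : ∀ {A : Set} {p q : A → Bool} → p ≗ q → ∀ xs → count p xs ≡ count q xs
count-cong p≗q [] = refl
count-cong {p = p} {q} p≗q (x ∷ xs) with p x | q x | p≗q x
... | true  | true  | _ = cong suc (count-cong p≗q xs)
... | false | false | _ = count-cong p≗q xs

count-map : ∀ {A B : Set} (p : B → Bool) (h : A → B) xs → count p (map h xs) ≡ count (p ∘ h) xs
count-map p h [] = refl
count-map p h (x ∷ xs) with p (h x)
... | true  = cong suc (count-map p h xs)
... | false = count-map p h xs

count-singleton : ∀ {A : Set} (p : A → Bool) x → count p (x ∷ []) ≡ 𝟙 (p x)
count-singleton p x with p x
... | true  = refl
... | false = refl

count-∧ : ∀ {A : Set} b (q : A → Bool) xs → count (λ x → b ∧ q x) xs ≡ 𝟙 b * count q xs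
count-∧ true q xs = sym (*-identityˡ (count q xs))
count-∧ false q [] = refl
count-∧ false q (x ∷ xs) = count-∧ false q xs

count-++ : ∀ {A : Set} (p : A → Bool) xs ys → count p (xs ++ ys) ≡ count p xs + count p ys
count-++ p xs ys = trans (cong length (filter-++ _ xs ys)) (length-++ (filterᵇ p xs))

count-concatMap-tabulate : ∀ {A B : Set} {m} (p : B → Bool) (F : A → List B) (g : Fin m → A) →
  count p (concatMap F (List.tabulate g)) ≡ sum (λ i → count p (F (g i)))
count-concatMap-tabulate {m = zero} p F g = refl
count-concatMap-tabulate {m = suc m} p F g =
  trans (count-++ p (F (g zero)) _) (cong (count p (F (g zero)) +_) (count-concatMap-tabulate p F (g ∘ suc)))

count-allMaps : ∀ {n m} (p : Vec (Fin n) (suc m) → Bool) →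
  count p (allMaps n (suc m)) ≡ sum (λ v → count (p ∘ (v ∷_)) (allMaps n m))
count-allMaps {n} {m} p = trans (count-concatMap-tabulate p (λ v → map (v ∷_) (allMaps n m)) id)
  (sum-cong-≗ λ v → count-map p (v ∷_) (allMaps n m))

module _ {n} (G : SimpleGraph n) where
  open Walks G

  count-walkᵇ : ∀ r u e → count (λ vs → walkᵇ G u vs e) (allMaps n r) ≡ W (suc r) u e
  count-walkᵇ zero u e = trans (count-singleton (λ vs → walkᵇ G u vs e) []) (sym (W-1 u e))
  count-walkᵇ (suc r) u e = trans (count-allMaps {n} {r} (λ vs → walkᵇ G u vs e)) (sum-cong-≗ λ v →
    trans (count-∧ (adj G u v) (λ vs → walkᵇ G v vs e) (allMaps n r)) (cong (A u v *_) (count-walkᵇ r v e)))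

  homCycle≡tr : ∀ r → homCycle (suc r) G ≡ tr (suc r)
  homCycle≡tr r = trans (count-allMaps {n} {r} (isHom (cycleAdj (suc r)) G)) (sum-cong-≗ λ u →
    trans (count-cong (isHom-cycle≡walkᵇ G u) (allMaps n r)) (count-walkᵇ r u u))

-- Counting by injections

lookup-injective : ∀ {A : Set} {xs : List A} → Unique xs → ∀ {i j} → List.lookup xs i ≡ List.lookup xs j → i ≡ j
lookup-injective (_ ∷ _) {zero} {zero} _ = refl
lookup-injective (x∉ ∷ _) {zero} {suc j} e = contradiction e (All.lookup x∉ (∈-lookup j))
lookup-injective (x∉ ∷ _) {suc i} {zero} e = contradiction (sym e) (All.lookup x∉ (∈-lookup i))
lookup-injective (_ ∷ u) {suc i} {suc j} e = cong suc (lookup-injective u e)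

-- The code may depend on the proof of `p x`, because the code of a closed walk is read off from the
-- witnesses of its edges.
count-≤ : ∀ {A : Set} {M} (p : A → Bool) {xs} → Unique xs →
  (code : ∀ x → p x ≡ true → Fin M) → (∀ x y px py → code x px ≡ code y py → x ≡ y) →
  count p xs ≤ M
count-≤ p {xs} unique code injective = injective⇒≤ {f = λ i → code (List.lookup ys i) (holds i)}
  (λ e → lookup-injective (filter⁺ (T? ∘ p) unique) (injective _ _ _ _ e))
  where
  ys = filterᵇ p xs
  holds : ∀ i → p (List.lookup ys i) ≡ true
  holds i = to T-≡ (proj₂ (∈-filter⁻ (T? ∘ p) {xs = xs} (∈-lookup i)))

≤-count : ∀ {A : Set} {M} (p : A → Bool) {xs} (f : Fin M → A) →
  (∀ i → f i ∈ xs) → (∀ i → p (f i) ≡ true) → (∀ i j → f i ≡ f j → i ≡ j) →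
  M ≤ count p xs
≤-count p {xs} f f∈ holds injective = injective⇒≤ {f = λ i → index (mem i)} (λ {i} {j} e → injective i j
  (trans (lookup-index (mem i)) (trans (cong (List.lookup (filterᵇ p xs)) e) (sym (lookup-index (mem j))))))
  where
  mem : ∀ i → f i ∈ filterᵇ p xs
  mem i = ∈-filter⁺ (T? ∘ p) (f∈ i) (from T-≡ (holds i))

∈-allMaps : ∀ {n m} (f : Vec (Fin n) m) → f ∈ allMaps n m
∈-allMaps [] = here refl
∈-allMaps {n} {suc m} (v ∷ f) = ∈-concatMap⁺ (λ v → map (v ∷_) (allMaps n m)) (lose (∈-allFin v) (∈-map⁺ (v ∷_) (∈-allMaps f)))

allMaps-unique : ∀ n m → Unique (allMaps n m)
allMaps-unique n zero = [] ∷ []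
allMaps-unique n (suc m) = subst Unique (sym (concatMap≡ (allFin n)))
  (cartesianProductWith⁺ _∷_ ∷-injective (allFin⁺ n) (allMaps-unique n m))
  where
  concatMap≡ : ∀ vs → concatMap (λ v → map (v ∷_) (allMaps n m)) vs ≡ List.cartesianProductWith _∷_ vs (allMaps n m)
  concatMap≡ [] = refl
  concatMap≡ (v ∷ vs) = cong (map (v ∷_) (allMaps n m) ++_) (concatMap≡ vs)

funToFin-cong : ∀ {m n} {f g : Fin m → Fin n} → f ≗ g → funToFin f ≡ funToFin g
funToFin-cong {zero} e = refl
funToFin-cong {suc m} e = cong₂ combine (e zero) (funToFin-cong (e ∘ suc))

finToFun-injective : ∀ {m n} {x y : Fin (n ^ m)} → finToFun {n} {m} x ≗ finToFun y → x ≡ y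
finToFun-injective {m} {n} {x} {y} e = trans (sym (funToFin-finToFin {m} {n} x)) (trans (funToFin-cong e) (funToFin-finToFin {m} {n} y))

funToFin-injective : ∀ {m n} {f g : Fin m → Fin n} → funToFin f ≡ funToFin g → f ≗ g
funToFin-injective {f = f} {g} e i = trans (sym (finToFun-funToFin f i)) (trans (cong (λ x → finToFun x i) e) (finToFun-funToFin g i))

-- The extremal graph

mod-suc : ∀ j r → suc j mod suc r ≡ next (j mod suc r)
mod-suc j r = toℕ-injective (begin
  toℕ (suc j mod suc r)              ≡⟨ toℕ-fromℕ< (m%n<n (suc j) (suc r)) ⟩
  suc j % suc r                      ≡⟨ cong (_% suc r) (+-comm 1 j) ⟩
  (j + 1) % suc r                    ≡⟨ %-distribˡ-+ j 1 (suc r) ⟩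
  (j % suc r + 1 % suc r) % suc r    ≡⟨ cong (λ x → (x + 1 % suc r) % suc r) (m%n%n≡m%n j (suc r)) ⟨
  (j % suc r % suc r + 1 % suc r) % suc r ≡⟨ %-distribˡ-+ (j % suc r) 1 (suc r) ⟨
  (j % suc r + 1) % suc r            ≡⟨ cong (λ x → (x + 1) % suc r) (toℕ-fromℕ< (m%n<n j (suc r))) ⟨
  (toℕ (j mod suc r) + 1) % suc r    ≡⟨ toℕ-next (j mod suc r) ⟨
  toℕ (next (j mod suc r))           ∎)
  where open ≡-Reasoning

toℕ-mod : ∀ {r} (i : Fin (suc r)) → toℕ i mod suc r ≡ i
toℕ-mod {r} i = toℕ-injective (trans (toℕ-fromℕ< (m%n<n (toℕ i) (suc r))) (m<n⇒m%n≡m (toℕ<n i)))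

n-mod-n : ∀ r → suc r mod suc r ≡ zero
n-mod-n r = toℕ-injective (trans (toℕ-fromℕ< (m%n<n (suc r) (suc r))) (n%n≡0 (suc r)))

does⇒ : ∀ {A : Set} (a? : Dec A) → does a? ≡ true → A
does⇒ (yes a) _ = a

module Extremal (p : ℕ) (isPrime : Prime p) (h : ℕ) where

  open Modular p
  open TruncatedSeries ℤ/p

  instance
    p-nonZero : NonZero p
    p-nonZero = prime⇒nonZero isPrime

  Vertex : Set
  Vertex = Fin (p ^ h)

  coordinate : Vertex → Fin h → Fin p
  coordinate = finToFun

  series : Vertex → Series
  series v zero = 1ℤ
  series v (suc i) with i <? h
  ... | yes i<h = ι (coordinate v (fromℕ< i<h))
  -- A default value at indices above h, outside the range compared by `≈[ h ]`.
  ... | no  _   = 0ℤ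

  series-coordinate : ∀ v j → series v (suc (toℕ j)) ≡ ι (coordinate v j)
  series-coordinate v j with toℕ j <? h
  ... | yes j<h = cong (ι ∘ coordinate v) (fromℕ<-toℕ j j<h)
  ... | no  j≮h = contradiction (toℕ<n j) j≮h

  series-injective : ∀ {u v} → series u ≈[ h ] series v → u ≡ v
  series-injective {u} {v} e = finToFun-injective {h} {p} λ j → ι-injective
    (subst₂ _≈ₚ_ (series-coordinate u j) (series-coordinate v j) (e (suc (toℕ j)) (toℕ<n j)))

  residues : Series → Fin h → Fin p
  residues w j = reduce (w (suc (toℕ j)))

  vertex : Series → Vertex
  vertex w = funToFin (residues w)

  series-vertex : ∀ w → w 0 ≈ₚ 1ℤ → series (vertex w) ≈[ h ] w
  series-vertex w w₀ zero _ = ≈ₚ-sym w₀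
  series-vertex w w₀ (suc i) i<h = subst (λ k → series (vertex w) (suc k) ≈ₚ w (suc k)) (toℕ-fromℕ< i<h)
    (≈ₚ-trans (≈ₚ-reflexive (trans (series-coordinate (vertex w) j) (cong ι (finToFun-funToFin (residues w) j)))) (ι-reduce (w (suc (toℕ j)))))
    where
    j = fromℕ< i<h

  -- Division-free form of: u = x (1 + s X) and v = x (1 + t X) for some x.
  Step : Vertex → Vertex → Fin p → Fin p → Set
  Step u v s t = mul (ι t) (series u) ≈[ h ] mul (ι s) (series v)

  Edge : Vertex → Vertex → Set
  Edge u v = ¬ u ≡ v × ∃ λ s → ∃ λ t → Step u v s t

  -- The factor 1 + s X is cancellable, so a vertex and the two labels of a step fix the next
  -- vertex.
  step-determines : ∀ {u u′ v v′ s s′ t t′} → u ≡ u′ → s ≡ s′ → t ≡ t′ →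
    Step u v s t → Step u′ v′ s′ t′ → v ≡ v′
  step-determines {v = v} {v′} {s} refl refl refl e e′ =
    series-injective (mul-injective {s = ι s} {series v} {series v′} λ i i≤h → ≈ₚ-trans (≈ₚ-sym (e i i≤h)) (e′ i i≤h))

  step? : ∀ u v s t → Dec (Step u v s t)
  step? u v s t = map′ upTo⇒step step⇒upTo (allUpTo? (λ i → x i ≈ₚ? y i) (suc h))
    where
    x = mul (ι t) (series u)
    y = mul (ι s) (series v)
    upTo⇒step : (∀ {i} → i < suc h → x i ≈ₚ y i) → x ≈[ h ] y
    upTo⇒step e i i≤h = e (s≤s i≤h)
    step⇒upTo : x ≈[ h ] y → ∀ {i} → i < suc h → x i ≈ₚ y i
    step⇒upTo e i<1+h = e _ (s≤s⁻¹ i<1+h)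

  edge? : ∀ u v → Dec (Edge u v)
  edge? u v = ¬? (u Fin.≟ v) ×-dec any? λ s → any? λ t → step? u v s t

  edge-sym : ∀ {u v} → Edge u v → Edge v u
  edge-sym (u≢v , s , t , e) = (u≢v ∘ sym) , t , s , ≈[]-sym e

  graph : SimpleGraph (p ^ h)
  graph = record
    { adj    = λ u v → does (edge? u v)
    ; sym    = λ u v → does-⇔ (mk⇔ edge-sym edge-sym) (edge? u v) (edge? v u)
    ; irrefl = irreflexive
    }
    where
    irreflexive : ∀ u → does (edge? u u) ≡ false
    irreflexive u with u Fin.≟ u
    ... | yes _ = refl
    ... | no u≢u = contradiction refl u≢u

  adj⇒edge : ∀ {u v} → adj graph u v ≡ true → Edge u v
  adj⇒edge {u} {v} = does⇒ (edge? u v)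

  edge⇒adj : ∀ {u v} → Edge u v → adj graph u v ≡ true
  edge⇒adj {u} {v} = dec-true (edge? u v)

  -- Upper bound for closed walks of length at most h

  module ClosedWalks (r : ℕ) (m≤h : suc r ≤ h) where

    m : ℕ
    m = suc r

    IsWalk : Vec Vertex m → Set
    IsWalk f = isHom (cycleAdj m) graph f ≡ true

    -- S lists the labels s of the steps, and φ tells which of them equals each label t. Thus the
    -- labels t cost only the constant m^m instead of p^m.
    encode : Vertex → (Fin m → Fin p) → (Fin m → Fin m) → Fin (p ^ h * (p ^ m * m ^ m))
    encode v S φ = combine v (combine (funToFin S) (funToFin φ))

    encode-injective : ∀ {v v′ S S′ φ φ′} → encode v S φ ≡ encode v′ S′ φ′ → v ≡ v′ × S ≗ S′ × φ ≗ φ′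
    encode-injective {v} {v′} {S} {S′} {φ} {φ′} e =
      combine-injectiveˡ v (combine (funToFin S) (funToFin φ)) v′ (combine (funToFin S′) (funToFin φ′)) e ,
      funToFin-injective (proj₁ inner) , funToFin-injective (proj₂ inner)
      where
      inner = combine-injective (funToFin S) (funToFin φ) (funToFin S′) (funToFin φ′)
        (combine-injectiveʳ v (combine (funToFin S) (funToFin φ)) v′ (combine (funToFin S′) (funToFin φ′)) e)

    module Walk (f : Vec Vertex m) (f-walk : IsWalk f) where

      edge : ∀ i → Edge (lookup f i) (lookup f (next i))
      edge i = adj⇒edge (to (isHom-cycle⇔ graph f) f-walk i)

      S R : Fin m → Fin p
      S i = proj₁ (proj₂ (edge i))
      R i = proj₁ (proj₂ (proj₂ (edge i)))

      -- The walk is continued periodically over ℕ, the index type of `muls` and `muls-telescope`.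
      at : ℕ → Vertex
      at j = lookup f (j mod m)

      step : ∀ j → Step (at j) (at (suc j)) (S (j mod m)) (R (j mod m))
      step j = subst (λ i → Step (at j) (lookup f i) (S (j mod m)) (R (j mod m))) (sym (mod-suc j r))
                 (proj₂ (proj₂ (proj₂ (edge (j mod m)))))

      σ ρ : ℕ → ℤ
      σ j = ι (S (j mod m))
      ρ j = ι (R (j mod m))

      closed : muls m ρ (series (at 0)) ≈[ h ] muls m σ (series (at 0))
      closed = subst (λ i → muls m ρ (series (at 0)) ≈[ h ] muls m σ (series (lookup f i))) (n-mod-n r)
        (muls-telescope m σ ρ (λ j → series (at j)) step)

      abstract
        root : ∀ i → ∃ λ i′ → S i′ ≡ R i
        root i = residue (muls-roots (1≉0 isPrime) (zero-product isPrime) m σ ρ (series (at 0)) m≤h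
                            (≈ₚ-reflexive refl) closed (toℕ i) (toℕ<n i))
          where
          residue : (∃ λ j → j < m × σ j ≈ₚ ρ (toℕ i)) → ∃ λ i′ → S i′ ≡ R i
          residue (j , _ , e) = j mod m , trans (ι-injective e) (cong R (toℕ-mod i))

      match : Fin m → Fin m
      match i = proj₁ (root i)

      code : Fin (p ^ h * (p ^ m * m ^ m))
      code = encode (at 0) S match

    -- The labels t are recovered as S composed with `match`; then the walk is rebuilt from its
    -- first vertex one step at a time.
    code-injective : ∀ f g f-walk g-walk → Walk.code f f-walk ≡ Walk.code g g-walk → f ≡ g
    code-injective f g f-walk g-walk e = begin
      f                   ≡⟨ tabulate∘lookup f ⟨
      tabulate (lookup f)
        ≡⟨ tabulate-cong (λ i → subst (λ k → lookup f k ≡ lookup g k) (toℕ-mod i) (same (toℕ i))) ⟩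
      tabulate (lookup g) ≡⟨ tabulate∘lookup g ⟩
      g                   ∎
      where
      open ≡-Reasoning
      module F = Walk f f-walk
      module G = Walk g g-walk
      parts : F.at 0 ≡ G.at 0 × F.S ≗ G.S × F.match ≗ G.match
      parts = encode-injective e
      S≗ : F.S ≗ G.S
      S≗ = proj₁ (proj₂ parts)
      R≗ : F.R ≗ G.R
      R≗ i = begin
        F.R i           ≡⟨ proj₂ (F.root i) ⟨
        F.S (F.match i) ≡⟨ S≗ (F.match i) ⟩
        G.S (F.match i) ≡⟨ cong G.S (proj₂ (proj₂ parts) i) ⟩
        G.S (G.match i) ≡⟨ proj₂ (G.root i) ⟩
        G.R i           ∎
      same : ∀ j → F.at j ≡ G.at j
      same zero = proj₁ parts
      same (suc j) = step-determines {F.at j} {G.at j} (same j) (S≗ (j mod m)) (R≗ (j mod m)) (F.step j) (G.step j)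

    homCycle-≤ : homCycle m graph ≤ p ^ h * (p ^ m * m ^ m)
    homCycle-≤ = count-≤ (isHom (cycleAdj m) graph) (allMaps-unique (p ^ h) m) Walk.code code-injective

  -- Lower bound from walks inside one clique

  module CliqueWalks (2≤h : 2 ≤ h) (r q : ℕ) (ℓq≤p : suc (suc r) * q ≤ p) where

    ℓ : ℕ
    ℓ = suc (suc r)

    -- Disjoint ranges for the different i make consecutive vertices distinct.
    label : Fin ℓ → Fin q → Fin p
    label i y = inject≤ (combine i y) ℓq≤p

    label-injective : ∀ {i j y z} → label i y ≡ label j z → i ≡ j × y ≡ z
    label-injective {i} {j} {y} {z} e = combine-injective i y j z (inject≤-injective ℓq≤p ℓq≤p (combine i y) (combine j z) e)

    -- The vertices x (1 + s X), for fixed x and varying s, form the clique attached to x.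
    translate : Vertex → Fin p → Vertex
    translate x s = vertex (mul (ι s) (series x))

    series-translate : ∀ x s → series (translate x s) ≈[ h ] mul (ι s) (series x)
    series-translate x s = series-vertex (mul (ι s) (series x)) (≈ₚ-reflexive refl)

    translate≡ : ∀ {x y s t} → translate x s ≡ translate y t → mul (ι s) (series x) ≈[ h ] mul (ι t) (series y)
    translate≡ {x} {y} {s} {t} e i i≤h = ≈ₚ-trans (≈ₚ-sym (series-translate x s i i≤h))
      (≈ₚ-trans (≈ₚ-reflexive (cong (λ v → series v i) e)) (series-translate y t i i≤h))

    translate-injectiveˡ : ∀ {x y} s → translate x s ≡ translate y s → x ≡ y
    translate-injectiveˡ {x} {y} s e =
      series-injective (mul-injective {s = ι s} {series x} {series y} (translate≡ {x} {y} {s} {s} e))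

    translate-injectiveʳ : ∀ x {s t} → translate x s ≡ translate x t → s ≡ t
    translate-injectiveʳ x {s} {t} e = ι-injective (mul-injectiveˡ {s = ι s} {ι t} {series x} (<⇒≤ 2≤h)
      (≈ₚ-reflexive refl) (translate≡ {x} {x} {s} {t} e))

    -- Two vertices of a clique determine it.
    translate-sidon : ∀ {x y s s′ t t′} → ¬ s ≡ s′ →
      translate x s ≡ translate y t → translate x s′ ≡ translate y t′ → s ≡ t
    translate-sidon {x} {y} {s} {s′} {t} {t′} s≢s′ e e′ = conclude
      (muls-roots (1≉0 isPrime) (zero-product isPrime) 2 (pair s′ t) (pair t′ s) (series x) 2≤h (≈ₚ-reflexive refl)
        crossed 1 (s≤s (s≤s z≤n)))
      where
      pair : Fin p → Fin p → ℕ → ℤ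
      pair a b zero = ι a
      pair a b (suc _) = ι b
      -- Both sides equal (1 + t X)(1 + t′ X) y. Comparing roots puts s among s′ and t, and s′ is
      -- excluded.
      crossed : mul (ι s) (mul (ι t′) (series x)) ≈[ h ] mul (ι t) (mul (ι s′) (series x))
      crossed i i≤h =
        ≈ₚ-trans (mul-comm (ι s) (ι t′) (series x) i)
        (≈ₚ-trans (mul-cong {s = ι t′} {u = mul (ι s) (series x)} {mul (ι t) (series y)} (≈ₚ-reflexive refl) (translate≡ {x} {y} {s} {t} e) i i≤h)
        (≈ₚ-trans (mul-comm (ι t′) (ι t) (series y) i)
          (≈ₚ-sym (mul-cong {s = ι t} {u = mul (ι s′) (series x)} {mul (ι t′) (series y)} (≈ₚ-reflexive refl) (translate≡ {x} {y} {s′} {t′} e′) i i≤h))))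
      conclude : (∃ λ j → j < 2 × pair s′ t j ≈ₚ ι s) → s ≡ t
      conclude (zero , _ , s′≈s) = contradiction (sym (ι-injective s′≈s)) s≢s′
      conclude (suc zero , _ , t≈s) = sym (ι-injective t≈s)
      conclude (suc (suc _) , s≤s (s≤s ()) , _)

    walk : Vertex → (Fin ℓ → Fin q) → Vec Vertex ℓ
    walk x y = tabulate (λ i → translate x (label i (y i)))

    next≢ : ∀ (i : Fin ℓ) → ¬ i ≡ next i
    next≢ i e with view i
    ... | ‵fromℕ = contradiction (trans e (next-fromℕ (suc r))) λ ()
    ... | ‵inject₁ j = 1+n≢n (sym (trans (sym (toℕ-inject₁ j)) (cong toℕ (trans e (next-inject₁ j)))))

    translate-edge : ∀ x {s t} → ¬ s ≡ t → Edge (translate x s) (translate x t)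
    translate-edge x {s} {t} s≢t = (λ e → s≢t (translate-injectiveʳ x e)) , s , t , λ i i≤h →
      ≈ₚ-trans (mul-cong {s = ι t} (≈ₚ-reflexive refl) (series-translate x s) i i≤h)
      (≈ₚ-trans (mul-comm (ι t) (ι s) (series x) i)
        (≈ₚ-sym (mul-cong {s = ι s} (≈ₚ-reflexive refl) (series-translate x t) i i≤h)))

    walk-isHom : ∀ x y → isHom (cycleAdj ℓ) graph (walk x y) ≡ true
    walk-isHom x y = from (isHom-cycle⇔ graph (walk x y)) λ i →
      subst₂ (λ u v → adj graph u v ≡ true)
        (sym (lookup∘tabulate (λ i → translate x (s i)) i)) (sym (lookup∘tabulate (λ i → translate x (s i)) (next i)))
        (edge⇒adj (translate-edge x (λ e → next≢ i (proj₁ (label-injective {i} {next i} e)))))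
      where
      s : Fin ℓ → Fin p
      s i = label i (y i)

    -- The first two vertices have different labels, so `translate-sidon` identifies the first label
    -- in both cliques. Cancelling that factor gives x = x′, after which every vertex reveals its
    -- label.
    walk-injective : ∀ {x x′ y y′} → walk x y ≡ walk x′ y′ → x ≡ x′ × y ≗ y′
    walk-injective {x} {x′} {y} {y′} e = x≡x′ , λ i → proj₂ (label-injective {i} {i}
      (translate-injectiveʳ x (trans (at i) (cong (λ z → translate z (label i (y′ i))) (sym x≡x′)))))
      where
      at : ∀ i → translate x (label i (y i)) ≡ translate x′ (label i (y′ i))
      at i = trans (sym (lookup∘tabulate (λ i → translate x (label i (y i))) i))
        (trans (cong (λ f → lookup f i) e) (lookup∘tabulate (λ i → translate x′ (label i (y′ i))) i))
      s≡ : label zero (y zero) ≡ label zero (y′ zero)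
      s≡ = translate-sidon {x} {x′} {label zero (y zero)} {label (suc zero) (y (suc zero))} {t′ = label (suc zero) (y′ (suc zero))}
             (λ e → contradiction (proj₁ (label-injective {zero} {suc zero} e)) λ ()) (at zero) (at (suc zero))
      x≡x′ : x ≡ x′
      x≡x′ = translate-injectiveˡ (label zero (y zero)) (trans (at zero) (cong (translate x′) (sym s≡)))

    base : Fin (p ^ h * q ^ ℓ) → Vertex
    base c = quotient (q ^ ℓ) c

    labels : Fin (p ^ h * q ^ ℓ) → Fin ℓ → Fin q
    labels c = finToFun (remainder {p ^ h} (q ^ ℓ) c)

    decode : Fin (p ^ h * q ^ ℓ) → Vec Vertex ℓ
    decode c = walk (base c) (labels c)

    decode-injective : ∀ c d → decode c ≡ decode d → c ≡ d
    decode-injective c d e = begin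
      c                                            ≡⟨ combine-remQuot {p ^ h} (q ^ ℓ) c ⟨
      combine (base c) (remainder {p ^ h} (q ^ ℓ) c)
        ≡⟨ cong₂ combine (proj₁ parts) (finToFun-injective {ℓ} {q} (proj₂ parts)) ⟩
      combine (base d) (remainder {p ^ h} (q ^ ℓ) d) ≡⟨ combine-remQuot {p ^ h} (q ^ ℓ) d ⟩
      d                                            ∎
      where
      open ≡-Reasoning
      parts : base c ≡ base d × labels c ≗ labels d
      parts = walk-injective {base c} {base d} {labels c} {labels d} e

    ≤-homCycle : p ^ h * q ^ ℓ ≤ homCycle ℓ graph
    ≤-homCycle = ≤-count (isHom (cycleAdj ℓ) graph) decode (λ c → ∈-allMaps (decode c))
      (λ c → walk-isHom (base c) (labels c)) decode-injective

-- Euclid's argument: a prime factor of n! + 1 that is at most n would divide n! and hence 1.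
prime-above : ∀ n → ∃ λ p → Prime p × n < p
prime-above n with factorise (suc (n !))
... | record { factors = [] ; isFactorisation = eq } = contradiction (suc-injective eq) (≢-nonZero⁻¹ (n !) ⦃ n !≢0 ⦄)
... | record { factors = q ∷ qs ; isFactorisation = eq ; factorsPrime = isPrime ∷ _ } = q , isPrime , ≰⇒> λ q≤n →
  nonTrivial⇒≢1 ⦃ prime⇒nonTrivial isPrime ⦄ (∣1⇒≡1 (∣m+n∣m⇒∣n
    (subst (q ∣_) (trans (sym eq) (+-comm 1 (n !))) (m∣m*n _))
    (∣-trans (q∣q! q ⦃ prime⇒nonZero isPrime ⦄) (m≤n⇒m!∣n! q≤n))))
  where
  q∣q! : ∀ q .⦃ _ : NonZero q ⦄ → q ∣ q !
  q∣q! (suc q) = m∣m*n (q !)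

-- The inequality and its sharpness with explicit exponents

module _ (c d : ℕ) where

  private
    g = 2 + (c + d)
    ℓ = 2 + c

  cycle-inequality : ∀ m → c + d ≡ m + m → ∀ n (T : SimpleGraph n) → CycleIneq g ℓ (g * (c + d)) (d + c * g) T
  cycle-inequality m eq n T = subst₂ (λ x y → x ^ (g * (c + d)) * n ^ (g * (d + c * g)) ≤ y ^ (d + c * g) * n ^ (ℓ * (g * (c + d))))
    (sym (homCycle≡tr T (suc c))) (sym (homCycle≡tr T (suc (c + d)))) (tr-inequality T c d m eq)

  module Violation (a b : ℕ) (a*r<P*b : a * (d + c * g) < g * (c + d) * b)
                   (p : ℕ) (isPrime : Prime p) (large : ((2 * ℓ) ^ ℓ) ^ a * (g ^ g) ^ b + ℓ < p) where

    -- D is the loss from replacing p by q in the clique walks, `g ^ g` counts the possible maps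
    -- `match`, and K is their combined effect. By `large`, p exceeds K and is at least ℓ, so that q
    -- is positive.
    D = (2 * ℓ) ^ ℓ
    K = D ^ a * (g ^ g) ^ b
    q = p / ℓ
    N = p ^ g

    -- The truncation order g is the smallest for which `ClosedWalks` covers walks of length g.
    open Extremal p isPrime g

    p≤2ℓq : p ≤ 2 * ℓ * q
    p≤2ℓq = begin
      p               ≡⟨ m≡m%n+[m/n]*n p ℓ ⟩
      p % ℓ + q * ℓ   ≤⟨ +-monoˡ-≤ (q * ℓ) (<⇒≤ (m%n<n p ℓ)) ⟩
      ℓ + q * ℓ
        ≤⟨ +-monoˡ-≤ (q * ℓ) (≤-trans (≤-reflexive (sym (*-identityˡ ℓ))) (*-monoˡ-≤ ℓ 1≤q)) ⟩
      q * ℓ + q * ℓ   ≡⟨ r₁ q ℓ ⟩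
      2 * ℓ * q       ∎
      where
      open ≤-Reasoning
      r₁ : ∀ q l → q * l + q * l ≡ 2 * l * q
      r₁ = solve-∀
      1≤q : 1 ≤ q
      1≤q = m≥n⇒m/n>0 (≤-trans (m≤n+m ℓ K) (<⇒≤ large))

    hom-ℓ : p ^ (g + ℓ) ≤ D * homCycle ℓ graph
    hom-ℓ = begin
      p ^ (g + ℓ)             ≡⟨ ^-distribˡ-+-* p g ℓ ⟩
      N * p ^ ℓ               ≤⟨ *-monoʳ-≤ N (^-monoˡ-≤ ℓ p≤2ℓq) ⟩
      N * (2 * ℓ * q) ^ ℓ     ≡⟨ cong (N *_) (^-distribʳ-* ℓ (2 * ℓ) q) ⟩
      N * (D * q ^ ℓ)         ≡⟨ r₁ N D (q ^ ℓ) ⟩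
      D * (N * q ^ ℓ)
        ≤⟨ *-monoʳ-≤ D (CliqueWalks.≤-homCycle (s≤s (s≤s z≤n)) c q (≤-trans (≤-reflexive (*-comm ℓ q)) (m/n*n≤m p ℓ))) ⟩
      D * homCycle ℓ graph    ∎
      where
      open ≤-Reasoning
      r₁ : ∀ x y z → x * (y * z) ≡ y * (x * z)
      r₁ = solve-∀

    hom-g : homCycle g graph ≤ g ^ g * p ^ (g + g)
    hom-g = begin
      homCycle g graph         ≤⟨ ClosedWalks.homCycle-≤ (suc (c + d)) ≤-refl ⟩
      N * (N * g ^ g)          ≡⟨ r₁ N (g ^ g) ⟩
      g ^ g * (N * N)          ≡⟨ cong (g ^ g *_) (^-distribˡ-+-* p g g) ⟨
      g ^ g * p ^ (g + g)      ∎
      where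
      open ≤-Reasoning
      r₁ : ∀ x y → x * (x * y) ≡ y * (x * x)
      r₁ = solve-∀

    -- These are the powers of p on the two sides of the cycle inequality. Their difference is g (c
    -- + d) b - a (d + c g), a positive integer, so at least one full factor p is gained.
    exponents : suc ((g + g) * b + g * (ℓ * a)) ≤ (g + ℓ) * a + g * (g * b)
    exponents = begin
      suc ((g + g) * b + g * (ℓ * a))                        ≡⟨ r₁ a b c d ⟩
      (g + ℓ) * a + (g + g) * b + suc (a * (d + c * g))
        ≤⟨ +-monoʳ-≤ ((g + ℓ) * a + (g + g) * b) a*r<P*b ⟩
      (g + ℓ) * a + (g + g) * b + g * (c + d) * b            ≡⟨ r₂ a b c d ⟩
      (g + ℓ) * a + g * (g * b)                              ∎
      where
      open ≤-Reasoning
      r₁ : ∀ a b c d → let g = 2 + (c + d); ℓ = 2 + c in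
           suc ((g + g) * b + g * (ℓ * a)) ≡ (g + ℓ) * a + (g + g) * b + suc (a * (d + c * g))
      r₁ = solve-∀
      r₂ : ∀ a b c d → let g = 2 + (c + d); ℓ = 2 + c in
           (g + ℓ) * a + (g + g) * b + g * (c + d) * b ≡ (g + ℓ) * a + g * (g * b)
      r₂ = solve-∀

    violated : ¬ CycleIneq g ℓ a b graph
    violated ineq = <-irrefl refl (begin-strict
      p ^ ((g + ℓ) * a + g * (g * b))
        ≡⟨ ^-distribˡ-+-* p ((g + ℓ) * a) (g * (g * b)) ⟩
      p ^ ((g + ℓ) * a) * p ^ (g * (g * b))
        ≡⟨ cong₂ _*_ (^-*-assoc p (g + ℓ) a) (^-*-assoc p g (g * b)) ⟨
      (p ^ (g + ℓ)) ^ a * N ^ (g * b)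
        ≤⟨ *-monoˡ-≤ (N ^ (g * b)) (^-monoˡ-≤ a hom-ℓ) ⟩
      (D * homCycle ℓ graph) ^ a * N ^ (g * b)
        ≡⟨ trans (cong (_* N ^ (g * b)) (^-distribʳ-* a D (homCycle ℓ graph))) (*-assoc (D ^ a) _ _) ⟩
      D ^ a * (homCycle ℓ graph ^ a * N ^ (g * b))
        ≤⟨ *-monoʳ-≤ (D ^ a) ineq ⟩
      D ^ a * (homCycle g graph ^ b * N ^ (ℓ * a))
        ≤⟨ *-monoʳ-≤ (D ^ a) (*-monoˡ-≤ (N ^ (ℓ * a)) (^-monoˡ-≤ b hom-g)) ⟩
      D ^ a * ((g ^ g * p ^ (g + g)) ^ b * N ^ (ℓ * a))
        ≡⟨ cong₂ (λ x y → D ^ a * (x * y)) (trans (^-distribʳ-* b (g ^ g) (p ^ (g + g))) (cong ((g ^ g) ^ b *_) (^-*-assoc p (g + g) b)))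
             (^-*-assoc p g (ℓ * a)) ⟩
      D ^ a * ((g ^ g) ^ b * p ^ ((g + g) * b) * p ^ (g * (ℓ * a)))
        ≡⟨ r₁ (D ^ a) ((g ^ g) ^ b) _ _ ⟩
      K * (p ^ ((g + g) * b) * p ^ (g * (ℓ * a)))
        ≡⟨ cong (K *_) (^-distribˡ-+-* p ((g + g) * b) (g * (ℓ * a))) ⟨
      K * p ^ E
        -- The gained factor p outweighs the accumulated constant K.
        <⟨ *-monoˡ-< (p ^ E) ⦃ m^n≢0 p E ⦄ (≤-<-trans (m≤m+n K ℓ) large) ⟩
      p * p ^ E
        ≤⟨ ^-monoʳ-≤ p exponents ⟩
      p ^ ((g + ℓ) * a + g * (g * b)) ∎)
      where
      open ≤-Reasoning
      E = (g + g) * b + g * (ℓ * a)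
      r₁ : ∀ x y z w → x * (y * z * w) ≡ x * y * (z * w)
      r₁ = solve-∀

  exponent-optimal : ∀ a b → a * (d + c * g) < g * (c + d) * b → Σ ℕ λ n → Σ (SimpleGraph n) λ T → 1 ≤ n × ¬ CycleIneq g ℓ a b T
  exponent-optimal a b a*r<P*b with prime-above (((2 * ℓ) ^ ℓ) ^ a * (g ^ g) ^ b + ℓ)
  ... | p , isPrime , large = p ^ g , Extremal.graph p isPrime g ,
    >-nonZero⁻¹ (p ^ g) ⦃ m^n≢0 p g ⦃ prime⇒nonZero isPrime ⦄ ⦄ , Violation.violated a b a*r<P*b p isPrime large

theorem4p1 : ∀ (k ℓ : ℕ) → 2 ≤ k → 2 ≤ ℓ → ℓ ≤ 2 * k →
    CycleConstantIs (2 * k) ℓ (4 * k * (k ∸ 1)) (2 * k * ℓ ∸ 2 * k ∸ ℓ)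
theorem4p1 (suc m) ℓ@(suc (suc c)) 2≤k (s≤s (s≤s _)) ℓ≤2k with m≤n⇒∃[o]m+o≡n ℓ≤2k
-- Here c = ℓ - 2, d = 2k - ℓ and m = k - 1, so that g = 2 + (c + d) is 2k.
... | d , g≡2k = transport g≡2k P≡ r≡
  ((λ n T _ → cycle-inequality c d m c+d≡m+m n T) , (λ a b _ _ → exponent-optimal c d a b))
  where
  open ≡-Reasoning
  k = suc m
  g = 2 + (c + d)
  transport : ∀ {g g′ P P′ r r′} → g ≡ g′ → P ≡ P′ → r ≡ r′ →
    CycleConstantIs g ℓ P r → CycleConstantIs g′ ℓ P′ r′
  transport refl refl refl C = C
  c+d≡m+m : c + d ≡ m + m
  c+d≡m+m = suc-injective (suc-injective (trans g≡2k (double m)))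
    where
    double : ∀ m → 2 * suc m ≡ 2 + (m + m)
    double = solve-∀
  P≡ : g * (c + d) ≡ 4 * k * (k ∸ 1)
  P≡ = trans (cong₂ _*_ g≡2k c+d≡m+m) (quadruple m)
    where
    quadruple : ∀ m → 2 * suc m * (m + m) ≡ 4 * suc m * m
    quadruple = solve-∀
  -- Writing g ℓ as the sum of g, ℓ and d + c g shows that neither truncated subtraction cuts off.
  r≡ : d + c * g ≡ 2 * k * ℓ ∸ 2 * k ∸ ℓ
  r≡ = begin
    d + c * g                          ≡⟨ m+n∸m≡n ℓ (d + c * g) ⟨
    ℓ + (d + c * g) ∸ ℓ                ≡⟨ cong (_∸ ℓ) (m+n∸m≡n g (ℓ + (d + c * g))) ⟨
    g + (ℓ + (d + c * g)) ∸ g ∸ ℓ      ≡⟨ cong (λ x → x ∸ g ∸ ℓ) (expand c d) ⟩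
    g * ℓ ∸ g ∸ ℓ                      ≡⟨ cong (λ x → x * ℓ ∸ x ∸ ℓ) g≡2k ⟩
    2 * k * ℓ ∸ 2 * k ∸ ℓ              ∎
    where
    expand : ∀ c d → let g = 2 + (c + d); ℓ = 2 + c in g + (ℓ + (d + c * g)) ≡ g * ℓ
    expand = solve-∀
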